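{- Let $\mathbf{P}$ denote the Petersen graph. Then $\mathrm{exp}(\mathbf{P}) \le \frac{2}{3}$.
   Context: Graphs are finite and simple. The Petersen graph is the 10-vertex 3-regular graph whose vertices are the 2-element subsets of $\{1,2,3,4,5\}$, two being adjacent iff they are disjoint. For a graph $G$ and $X,Y\subset V(G)$, $e(X,Y)$ is the number of edges of $G$ with one vertex in $X$ and one vertex in $Y$, where edges with both vertices in $X\cap Y$ are counted twice. For real numbers $p\in[0,1]$ and $\alpha\ge 0$, $G$ is $(p,\alpha)$-jumbled if $\left|e(X,Y)-p|X||Y|\right|\le \alpha\sqrt{|X||Y|}$ for all $X,Y\subset V(G)$. A graph is $\mathcal{F}$-free, for a family $\mathcal{F}$ of graphs, if it contains no member of $\mathcal{F}$ as a (not necessarily induced) subgraph. For $C>0$, $\mathrm{ex}_{\mathrm{rand}}(n,C,\mathcal{F})$ is the maximum number of edges in an $n$-vertex $\mathcal{F}$-free graph that is $(p,\alpha)$-jumbled for some $p\in[0,1]$ and some $\alpha\ge 0$ with $\alpha\le C\sqrt{np}$ (there is no restriction on $p$). Define $$\mathrm{exp}(\mathcal{F})=\lim_{C\to\infty}\limsup_{n\to\infty}\frac{\log\left(\mathrm{ex}_{\mathrm{rand}}(n,C,\mathcal{F})/n\right)}{\log n},$$ and write $\mathrm{exp}(F)=\mathrm{exp}(\{F\})$. -}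

module Defs where

open import Algebra.Apartness.Structures using (IsHeytingField)
open import Algebra.Bundles using (CommutativeRing)
import Algebra.Definitions.RawMonoid as RawMonoid
import Algebra.Properties.Ring as RingProperties
open import Data.Bool.Base using (Bool; true; false; not; _∧_; _∨_; if_then_else_)
import Data.Bool.Properties as Bool
open import Data.Fin.Base using (Fin; zero; suc)
import Data.Fin.Properties as Fin
open import Data.Fin.Subset using (Subset; ⁅_⁆; _∪_; _∩_; ∣_∣)
open import Data.Fin.Subset.Properties using (nonempty?; ∩-comm; anySubset?)
open import Data.List.Base using (List; length; filter; cartesianProduct; allFin; map)
open import Data.List.Properties using (length-filter)
open import Data.Nat.Base as ℕ using (ℕ; zero; suc; NonZero)
open import Data.Nat.ListAction using (sum)
import Data.Nat.Properties as ℕ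
open import Data.Product.Base using (Σ; ∃; ∃-syntax; _×_; _,_; proj₁; proj₂)
open import Data.Sum.Base using (_⊎_; inj₁; inj₂; [_,_]′)
open import Data.Unit.Base using (⊤; tt)
open import Data.Vec.Base using (Vec; []; _∷_; lookup)
import Data.Vec.Properties as Vec
open import Function.Base using (_∘_)
open import Function.Definitions using (Injective)
open import Level using (0ℓ)
open import Relation.Binary.Core using (Rel)
open import Relation.Binary.Definitions using (Cotransitive)
open import Relation.Binary.Lattice.Definitions using (Supremum)
open import Relation.Binary.PropositionalEquality as ≡ using (_≡_)
open import Relation.Binary.Structures using (IsStrictPartialOrder)
open import Relation.Nullary.Decidable using (Dec; does; ¬?; from-yes; decidable-stable; _×-dec_; _→-dec_)
open import Relation.Nullary.Negation using (¬_; contradiction)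
open import Relation.Unary using (Pred; _∈_)

------------------------------------------------------------------------
-- Graphs

record Graph (n : ℕ) : Set where
  field
    adjacent : Fin n → Fin n → Bool
    sym      : ∀ i j → adjacent i j ≡ adjacent j i
    irrefl   : ∀ i → adjacent i i ≡ false

open Graph public using (adjacent)

private variable
  n k : ℕ

vertexPairs : ∀ n → List (Fin n × Fin n)
vertexPairs n = cartesianProduct (allFin n) (allFin n)

-- Each edge {i , j} occurs exactly once, as the pair (i , j) with i < j.
edges : Graph n → List (Fin n × Fin n)
edges {n} G = filter
  (λ (i , j) → (i Fin.<? j) ×-dec (adjacent G i j Bool.≟ true))
  (vertexPairs n)

edgeCount : Graph n → ℕ
edgeCount G = length (edges G)

weight : Subset n → Subset n → Fin n × Fin n → ℕ
weight X Y (i , j) =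
  if both then 2 else if across then 1 else 0
  where
  inX = lookup X
  inY = lookup Y
  both   = (inX i ∧ inY i) ∧ (inX j ∧ inY j)
  across = (inX i ∧ inY j) ∨ (inX j ∧ inY i)

-- Edges with both endpoints in X ∩ Y are counted twice.
e : Graph n → Subset n → Subset n → ℕ
e G X Y = sum (map (weight X Y) (edges G))

-- H is isomorphic to a not necessarily induced subgraph of G.
_IsSubgraphOf_ : Graph k → Graph n → Set
_IsSubgraphOf_ {k} {n} H G = Σ (Fin k → Fin n) λ f →
  Injective _≡_ _≡_ f ×
  (∀ i j → adjacent H i j ≡ true → adjacent G (f i) (f j) ≡ true)

Family : Set₁
Family = Pred (∃ Graph) 0ℓ

_-free : Family → Graph n → Set
(𝓕 -free) G = ∀ {k} (H : Graph k) → (k , H) ∈ 𝓕 → ¬ (H IsSubgraphOf G)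

twoSubsets : Vec (Subset 5) 10
twoSubsets =
  (⁅ v₁ ⁆ ∪ ⁅ v₂ ⁆) ∷ (⁅ v₁ ⁆ ∪ ⁅ v₃ ⁆) ∷ (⁅ v₁ ⁆ ∪ ⁅ v₄ ⁆) ∷ (⁅ v₁ ⁆ ∪ ⁅ v₅ ⁆) ∷
  (⁅ v₂ ⁆ ∪ ⁅ v₃ ⁆) ∷ (⁅ v₂ ⁆ ∪ ⁅ v₄ ⁆) ∷ (⁅ v₂ ⁆ ∪ ⁅ v₅ ⁆) ∷
  (⁅ v₃ ⁆ ∪ ⁅ v₄ ⁆) ∷ (⁅ v₃ ⁆ ∪ ⁅ v₅ ⁆) ∷ (⁅ v₄ ⁆ ∪ ⁅ v₅ ⁆) ∷ []
  where
  v₁ v₂ v₃ v₄ v₅ : Fin 5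
  v₁ = zero
  v₂ = suc zero
  v₃ = suc (suc zero)
  v₄ = suc (suc (suc zero))
  v₅ = suc (suc (suc (suc zero)))

-- twoSubsets lists every 2-element subset, without repetition.
twoSubsets-complete : ∀ S → ∣ S ∣ ≡ 2 → ∃[ i ] lookup twoSubsets i ≡ S
twoSubsets-complete S ∣S∣≡2 = decidable-stable (listed? S)
  (λ ¬listed → none (S , ∣S∣≡2 , ¬listed))
  where
  listed? : ∀ S → Dec (∃[ i ] lookup twoSubsets i ≡ S)
  listed? S = Fin.any? (λ i → Vec.≡-dec Bool._≟_ (lookup twoSubsets i) S)

  none : ¬ (∃[ S ] (∣ S ∣ ≡ 2 × ¬ (∃[ i ] lookup twoSubsets i ≡ S)))
  none = from-yes (¬? (anySubset? λ S → (∣ S ∣ ℕ.≟ 2) ×-dec ¬? (listed? S)))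

twoSubsets-size : ∀ i → ∣ lookup twoSubsets i ∣ ≡ 2
twoSubsets-size = from-yes (Fin.all? λ i → ∣ lookup twoSubsets i ∣ ℕ.≟ 2)

twoSubsets-distinct : ∀ i j → lookup twoSubsets i ≡ lookup twoSubsets j → i ≡ j
twoSubsets-distinct = from-yes (Fin.all? λ i → Fin.all? λ j →
  Vec.≡-dec Bool._≟_ (lookup twoSubsets i) (lookup twoSubsets j) →-dec (i Fin.≟ j))

petersen : Graph 10
petersen = record
  { adjacent = λ i j → disjoint (lookup twoSubsets i) (lookup twoSubsets j)
  ; sym      = λ i j → ≡.cong (not ∘ does ∘ nonempty?) (∩-comm (lookup twoSubsets i) (lookup twoSubsets j))
  ; irrefl   = from-yes (Fin.all? λ i → disjoint (lookup twoSubsets i) (lookup twoSubsets i) Bool.≟ false)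
  }
  where
  disjoint : Subset 5 → Subset 5 → Bool
  disjoint S T = not (does (nonempty? (S ∩ T)))

IsMaximum : Pred ℕ 0ℓ → ℕ → Set
IsMaximum P m = P m × (∀ k → P k → k ℕ.≤ m)

------------------------------------------------------------------------
-- Real numbers

-- The standard library has no reals.  They are axiomatised here as a
-- Cauchy-complete Archimedean ordered field, which (classically)
-- determines them up to isomorphism; √ and log are included with their characterising
-- properties, and are likewise determined by these.  The axioms are the
-- constructively valid ones (no decidable order), so that they hold of,
-- for instance, Bishop's reals.

record RealNumbers : Set₁ where
  infix  8 -_ √_
  infixl 7 _*_
  infixl 6 _+_ _-_ _⊔_
  infix  4 _≈_ _<_ _≤_ _#_
  field
    Carrier : Set
    _≈_ _<_ : Rel Carrier 0ℓ
    _+_ _*_ : Carrier → Carrier → Carrier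
    -_      : Carrier → Carrier
    0# 1#   : Carrier

  _#_ : Rel Carrier 0ℓ
  x # y = x < y ⊎ y < x

  _≤_ : Rel Carrier 0ℓ
  x ≤ y = ¬ (y < x)

  field
    isHeytingField       : IsHeytingField _≈_ _#_ _+_ _*_ -_ 0# 1#
    isStrictPartialOrder : IsStrictPartialOrder _≈_ _<_
    <-cotrans            : Cotransitive _<_
    0<1                  : 0# < 1#
    +-mono-<             : ∀ {x y} z → x < y → x + z < y + z
    *-mono-<             : ∀ {x y} z → 0# < z → x < y → x * z < y * z
    _⊔_                  : Carrier → Carrier → Carrier
    ⊔-supremum           : Supremum _≤_ _⊔_

  _-_ : Carrier → Carrier → Carrier
  x - y = x + (- y)

  abs : Carrier → Carrier
  abs x = x ⊔ (- x)

  fromℕ : ℕ → Carrier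
  fromℕ n = RawMonoid._×_ (record { _≈_ = _≈_ ; _∙_ = _+_ ; ε = 0# }) n 1#

  field
    archimedean : ∀ x → ∃[ n ] x < fromℕ n
    complete    : ∀ (s : ℕ → Carrier) →
      (∀ ε → 0# < ε → ∃[ N ] (∀ m n → N ℕ.≤ m → N ℕ.≤ n → abs (s m - s n) < ε)) →
      ∃[ x ] (∀ ε → 0# < ε → ∃[ N ] (∀ n → N ℕ.≤ n → abs (s n - x) < ε))

  ℝ⁺ : Set
  ℝ⁺ = ∃[ x ] 0# < x

  field
    -- Only the values at non-negative reals are specified.
    √_       : Carrier → Carrier
    √-nonneg : ∀ x → 0# ≤ x → 0# ≤ √ x
    √-square : ∀ x → 0# ≤ x → √ x * √ x ≈ x

    -- Among the homomorphisms from (ℝ⁺ , *) to (ℝ , +), the bound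
    -- log x ≤ x - 1 singles out the natural logarithm.
    log      : ℝ⁺ → Carrier
    log-cong : ∀ x y → proj₁ x ≈ proj₁ y → log x ≈ log y
    log-*    : ∀ x y (0<xy : 0# < proj₁ x * proj₁ y) →
               log (proj₁ x * proj₁ y , 0<xy) ≈ log x + log y
    log-≤    : ∀ x → log x ≤ proj₁ x - 1#

  open IsHeytingField isHeytingField public
    using (isCommutativeRing; #⇒invertible; invertible⇒#)
  open IsStrictPartialOrder isStrictPartialOrder public
    using () renaming
    (irrefl to <-irrefl; trans to <-trans; <-respʳ-≈ to <-respʳ; <-respˡ-≈ to <-respˡ)

  commutativeRing : CommutativeRing 0ℓ 0ℓ
  commutativeRing = record { isCommutativeRing = isCommutativeRing }

  open CommutativeRing commutativeRing public
    using ( setoid; refl; sym; trans; ring; +-comm; +-assoc; +-cong; +-congˡ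
          ; +-identityˡ; +-identityʳ; -‿inverseˡ; -‿inverseʳ; *-comm; *-assoc; *-cong
          ; *-congˡ; *-congʳ; *-identityˡ; *-identityʳ; zeroˡ; zeroʳ; distribˡ; distribʳ)

module RealProperties (ℝ : RealNumbers) where
  open RealNumbers ℝ
  open RingProperties ring using (-‿distribʳ-*; -0#≈0#; -‿distribˡ-*)

  ≤-refl : ∀ {x} → x ≤ x
  ≤-refl = <-irrefl refl

  <⇒≤ : ∀ {x y} → x < y → x ≤ y
  <⇒≤ x<y y<x = <-irrefl refl (<-trans x<y y<x)

  ≤-<-trans : ∀ {x y z} → x ≤ y → y < z → x < z
  ≤-<-trans {x} x≤y y<z with <-cotrans y<z x
  ... | inj₁ y<x = contradiction y<x x≤y
  ... | inj₂ x<z = x<z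

  <-≤-trans : ∀ {x y z} → x < y → y ≤ z → x < z
  <-≤-trans {z = z} x<y y≤z with <-cotrans x<y z
  ... | inj₁ x<z = x<z
  ... | inj₂ z<y = contradiction z<y y≤z

  ≤-trans : ∀ {x y z} → x ≤ y → y ≤ z → x ≤ z
  ≤-trans x≤y y≤z z<x = y≤z (<-≤-trans z<x x≤y)

  +-monoʳ-< : ∀ {x y} z → x < y → z + x < z + y
  +-monoʳ-< z x<y = <-respʳ (+-comm _ z) (<-respˡ (+-comm _ z) (+-mono-< z x<y))

  <⇒0<- : ∀ {x y} → x < y → 0# < y - x
  <⇒0<- {x} x<y = <-respˡ (-‿inverseʳ x) (+-mono-< (- x) x<y)

  0<-⇒< : ∀ {x y} → 0# < y - x → x < y
  0<-⇒< {x} {y} p = <-respʳ cancel (<-respˡ (+-identityˡ x) (+-mono-< x p))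
    where
    cancel : y - x + x ≈ y
    cancel = trans (+-assoc y (- x) x) (trans (+-congˡ (-‿inverseˡ x)) (+-identityʳ y))

  x-0≈x : ∀ x → x - 0# ≈ x
  x-0≈x x = trans (+-congˡ -0#≈0#) (+-identityʳ x)

  x<1+x : ∀ x → x < 1# + x
  x<1+x x = <-respˡ (+-identityˡ x) (+-mono-< x 0<1)

  x-1<x : ∀ x → x - 1# < x
  x-1<x x = 0<-⇒< (<-respʳ (sym eq) 0<1)
    where
    open RingProperties ring using (-‿+-comm; -‿involutive)
    eq : x - (x - 1#) ≈ 1#
    eq = trans (+-congˡ (sym (-‿+-comm x (- 1#))))
        (trans (sym (+-assoc x (- x) (- - 1#)))
        (trans (+-cong (-‿inverseʳ x) (-‿involutive 1#)) (+-identityˡ 1#)))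

  0≤fromℕ : ∀ n → 0# ≤ fromℕ n
  0<fromℕ : ∀ n → .{{NonZero n}} → 0# < fromℕ n
  0<fromℕ (suc n) = ≤-<-trans (0≤fromℕ n) (x<1+x (fromℕ n))
  0≤fromℕ zero    = ≤-refl
  0≤fromℕ (suc n) = <⇒≤ (0<fromℕ (suc n))

  fromℕ-mono-< : ∀ {m n} → m ℕ.< n → fromℕ m < fromℕ n
  fromℕ-mono-< {m} {suc n} m<1+n with ℕ.m≤n⇒m<n∨m≡n (ℕ.s≤s⁻¹ m<1+n)
  ... | inj₁ m<n    = <-trans (fromℕ-mono-< m<n) (x<1+x (fromℕ n))
  ... | inj₂ ≡.refl = x<1+x (fromℕ n)

  *-pos : ∀ {x y} → 0# < x → 0# < y → 0# < x * y
  *-pos {y = y} 0<x 0<y = <-respˡ (zeroˡ y) (*-mono-< y 0<y 0<x)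

  xy≈1⇒x#0 : ∀ {x y} → x * y ≈ 1# → x # 0#
  xy≈1⇒x#0 {x} {y} xy≈1 = invertible⇒#
    (y , trans (*-congˡ (x-0≈x x)) (trans (*-comm y x) xy≈1)
       , trans (*-congʳ (x-0≈x x)) xy≈1)

  abstract
    inverse : ∀ ((x , _) : ℝ⁺) → ∃[ y ] (0# < y × x * y ≈ 1#)
    inverse (x , 0<x) with #⇒invertible {x} {0#} (inj₂ 0<x)
    ... | y , _ , [x-0]y≈1 = y , 0<y (xy≈1⇒x#0 (trans (*-comm y x) xy≈1)) , xy≈1
      where
      xy≈1 : x * y ≈ 1#
      xy≈1 = trans (*-congʳ (sym (x-0≈x x))) [x-0]y≈1

      0<y : y # 0# → 0# < y
      0<y (inj₂ 0<y) = 0<y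
      0<y (inj₁ y<0) = contradiction
        (<-respˡ (trans (*-comm y x) xy≈1) (<-respʳ (zeroˡ x) (*-mono-< x 0<x y<0)))
        (<⇒≤ 0<1)

  infixl 7 _÷_
  _÷_ : Carrier → ℝ⁺ → Carrier
  x ÷ y = x * proj₁ (inverse y)

  ÷-pos : ∀ {x} y → 0# < x → 0# < x ÷ y
  ÷-pos y 0<x = *-pos 0<x (proj₁ (proj₂ (inverse y)))

  ÷-mono-< : ∀ {x y} z → x < y → x ÷ z < y ÷ z
  ÷-mono-< z = *-mono-< _ (proj₁ (proj₂ (inverse z)))

  x÷x≈1 : ∀ x → proj₁ x ÷ x ≈ 1#
  x÷x≈1 x = proj₂ (proj₂ (inverse x))

  x÷y*y≈x : ∀ x y → x ÷ y * proj₁ y ≈ x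
  x÷y*y≈x x y = trans (*-assoc x _ _)
    (trans (*-congˡ (trans (*-comm _ _) (x÷x≈1 y))) (*-identityʳ x))

  fromℕ⁺ : ∀ n → .{{NonZero n}} → ℝ⁺
  fromℕ⁺ n = fromℕ n , 0<fromℕ n

  dense : ∀ {x y} → x < y → ∃[ z ] (x < z × z < y)
  dense {x} {y} x<y = (x + y) ÷ two
    , <-respˡ (half x) (÷-mono-< two (+-monoʳ-< x x<y))
    , <-respʳ (half y) (÷-mono-< two (+-mono-< y x<y))
    where
    two : ℝ⁺
    two = fromℕ⁺ 2

    double : ∀ z → z + z ≈ z * fromℕ 2
    double z = sym (trans (distribˡ z 1# (1# + 0#))
      (+-cong (*-identityʳ z) (trans (*-congˡ (+-identityʳ 1#)) (*-identityʳ z))))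

    half : ∀ z → (z + z) ÷ two ≈ z
    half z = trans (*-congʳ (double z))
      (trans (*-assoc z _ _) (trans (*-congˡ (x÷x≈1 two)) (*-identityʳ z)))

  *-monoʳ-≤ : ∀ {x y z} → 0# ≤ z → x ≤ y → x * z ≤ y * z
  *-monoʳ-≤ {x} {y} {z} 0≤z x≤y yz<xz = x≤y (0<-⇒< 0<d)
    where
    d : Carrier
    d = x - y

    0<dz : 0# < d * z
    0<dz = <-respʳ
      (sym (trans (distribʳ z x (- y)) (+-congˡ (sym (-‿distribˡ-* y z)))))
      (<⇒0<- yz<xz)

    z#0 : z # 0#
    z#0 = xy≈1⇒x#0 (trans (sym (*-assoc z d _))
      (trans (*-congʳ (*-comm z d)) (x÷x≈1 (d * z , 0<dz))))

    0<d : 0# < d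
    0<d with z#0
    ... | inj₁ z<0 = contradiction z<0 0≤z
    ... | inj₂ 0<z = <-respʳ
      (trans (*-assoc d z _) (trans (*-congˡ (x÷x≈1 (z , 0<z))) (*-identityʳ d)))
      (÷-pos (z , 0<z) 0<dz)

  log1≈0 : log (1# , 0<1) ≈ 0#
  log1≈0 = x+x≈x⇒x≈0 _ (trans (sym (log-* (1# , 0<1) (1# , 0<1) (*-pos 0<1 0<1)))
    (log-cong _ _ (*-identityˡ 1#)))
    where
    open RingProperties ring using (x+x≈x⇒x≈0)

  1<x⇒0<log : ∀ x → 1# < proj₁ x → 0# < log x
  1<x⇒0<log x@(r , 0<r) 1<r = <-respˡ sum≈0 (<-respʳ (+-identityʳ _) (+-monoʳ-< (log x) log-w<0))
    where
    w : ℝ⁺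
    w = proj₁ (inverse x) , proj₁ (proj₂ (inverse x))

    w<1 : proj₁ w < 1#
    w<1 = <-respˡ (*-identityˡ _) (<-respʳ (x÷x≈1 x) (÷-mono-< x 1<r))

    log-w<0 : log w < 0#
    log-w<0 = ≤-<-trans (log-≤ w) (<-respʳ (-‿inverseʳ 1#) (+-mono-< (- 1#) w<1))

    sum≈0 : log x + log w ≈ 0#
    sum≈0 = trans (sym (log-* x w (÷-pos x 0<r)))
      (trans (log-cong _ _ (x÷x≈1 x)) log1≈0)

  log-mono-< : ∀ x y → proj₁ x < proj₁ y → log x < log y
  log-mono-< x y x<y = <-respˡ (+-identityˡ _)
    (<-respʳ (trans (sym (log-* z x (*-pos (proj₂ z) (proj₂ x)))) (log-cong _ _ (x÷y*y≈x (proj₁ y) x)))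
      (+-mono-< (log x) (1<x⇒0<log z 1<z)))
    where
    z : ℝ⁺
    z = proj₁ y ÷ x , ÷-pos x (proj₂ y)

    1<z : 1# < proj₁ z
    1<z = <-respˡ (x÷x≈1 x) (÷-mono-< x x<y)

------------------------------------------------------------------------
-- Suprema, infima and limits in the extended reals

-- Constructively a limsup need not exist as a located real number, so
-- an extended real x is represented by the set of reals q with x < q;
-- classically these sets correspond exactly to the elements of [-∞ , +∞].
-- Every family then has a supremum and an infimum.

module ExtendedReals (ℝ : RealNumbers) where
  open RealNumbers ℝ using (Carrier; _<_; 0#; 1#; _-_; <-trans)
  open RealProperties ℝ using (dense; x-1<x)

  record ℝ̄ : Set₁ where
    field
      _<∙_    : Carrier → Set
      upward  : ∀ {q r} → _<∙_ q → q < r → _<∙_ r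
      rounded : ∀ {r} → _<∙_ r → ∃[ q ] (q < r × _<∙_ q)

  infix 4 _≺_ _≼_

  _≺_ : ℝ̄ → Carrier → Set
  x ≺ q = ℝ̄._<∙_ x q

  _≼_ : ℝ̄ → ℝ̄ → Set
  x ≼ y = ∀ q → y ≺ q → x ≺ q

  ⌜_⌝ : Carrier → ℝ̄
  ⌜ x ⌝ = record
    { _<∙_    = x <_
    ; upward  = <-trans
    ; rounded = λ x<r → let q , x<q , q<r = dense x<r in q , q<r , x<q
    }

  -∞ : ℝ̄
  -∞ = record
    { _<∙_    = λ _ → ⊤
    ; upward  = λ _ _ → tt
    ; rounded = λ {r} _ → r - 1# , x-1<x r , tt
    }

  ⨆ : {I : Set} → (I → ℝ̄) → ℝ̄
  ⨆ x = record
    { _<∙_    = λ r → ∃[ q ] (q < r × ∀ i → x i ≺ q)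
    ; upward  = λ (q , q<r , x≺q) r<s → q , <-trans q<r r<s , x≺q
    ; rounded = λ (q , q<r , x≺q) → let s , q<s , s<r = dense q<r in s , s<r , q , q<s , x≺q
    }

  ⨅ : {I : Set} → (I → ℝ̄) → ℝ̄
  ⨅ x = record
    { _<∙_    = λ r → ∃[ i ] x i ≺ r
    ; upward  = λ (i , x≺q) q<r → i , ℝ̄.upward (x i) x≺q q<r
    ; rounded = λ (i , x≺r) → let q , q<r , x≺q = ℝ̄.rounded (x i) x≺r in q , q<r , i , x≺q
    }

  limsup liminf : {I : Set} → Rel I 0ℓ → (I → ℝ̄) → ℝ̄
  limsup _⊑_ x = ⨅ λ i → ⨆ λ ((j , _) : ∃[ j ] i ⊑ j) → x j
  liminf _⊑_ x = ⨆ λ i → ⨅ λ ((j , _) : ∃[ j ] i ⊑ j) → x j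

------------------------------------------------------------------------
-- Jumbled graphs and the exponent

module Exponent (ℝ : RealNumbers) where
  open RealNumbers ℝ hiding (sym)
  open RealProperties ℝ
  open ExtendedReals ℝ public

  infixl 7 _/_
  _/_ : ℕ → (n : ℕ) → .{{NonZero n}} → Carrier
  m / n = fromℕ m ÷ fromℕ⁺ n

  IsJumbled : Carrier → Carrier → Graph n → Set
  IsJumbled p α G = ∀ X Y →
    let x = fromℕ ∣ X ∣
        y = fromℕ ∣ Y ∣
    in abs (fromℕ (e G X Y) - p * (x * y)) ≤ α * √ (x * y)

  IsRandomLike : ℝ⁺ → Graph n → Set
  IsRandomLike {n} (C , _) G = ∃[ p ] ∃[ α ]
    (0# ≤ p × p ≤ 1#) × 0# ≤ α × α ≤ C * √ (fromℕ n * p) × IsJumbled p α G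

  IsEdgeCount : ∀ n → ℝ⁺ → Family → Pred ℕ 0ℓ
  IsEdgeCount n C 𝓕 m = Σ (Graph n) λ G →
    (𝓕 -free) G × IsRandomLike C G × edgeCount G ≡ m

  -- ex-rand n C 𝓕 m: the maximum number of edges exists and equals m.
  -- (Since jumbledness is undecidable, the maximum is not computable
  -- from n, C and 𝓕, so the function is given as a relation.)
  ex-rand : ∀ n → ℝ⁺ → Family → Pred ℕ 0ℓ
  ex-rand n C 𝓕 = IsMaximum (IsEdgeCount n C 𝓕)

  _/⁺_ : ∀ m n → .{{NonZero m}} → .{{NonZero n}} → ℝ⁺
  m /⁺ n = m / n , ÷-pos (fromℕ⁺ n) (0<fromℕ m)

  -- log (2 + n), which is positive.
  log⁺ : ∀ n → ℝ⁺
  log⁺ n = log (fromℕ⁺ (2 ℕ.+ n)) , 1<x⇒0<log _ 1<2+n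
    where
    1<2+n : 1# < fromℕ (2 ℕ.+ n)
    1<2+n = <-respˡ (+-identityʳ 1#) (fromℕ-mono-< {1} {2 ℕ.+ n} (ℕ.s≤s (ℕ.s≤s ℕ.z≤n)))

  -- log (m / n) / log n, with log 0 = -∞.  The values for n < 2, where
  -- log n is not positive, are arbitrary; they do not affect a limsup.
  logRatio : (n m : ℕ) → ℝ̄
  logRatio 0               _         = -∞
  logRatio 1               _         = -∞
  logRatio (suc (suc n-2)) 0         = -∞
  logRatio n@(suc (suc n-2)) m@(suc _) = ⌜ log (m /⁺ n) ÷ log⁺ n-2 ⌝

  -- The supremum is over the single value m = ex-rand n C 𝓕.
  term : ℝ⁺ → Family → ℕ → ℝ̄
  term C 𝓕 n = ⨆ λ ((m , _) : ∃ (ex-rand n C 𝓕)) → logRatio n m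

  expAt : Family → ℝ⁺ → ℝ̄
  expAt 𝓕 C = limsup ℕ._≤_ (term C 𝓕)

  _≤⁺_ : Rel ℝ⁺ 0ℓ
  C ≤⁺ D = proj₁ C ≤ proj₁ D

  -- The limit as C → ∞ of expAt 𝓕 C.  It is defined as the limsup; by
  -- exp-isLimit below this is also the liminf, so it is the limit.
  exp : Family → ℝ̄
  exp 𝓕 = limsup _≤⁺_ (expAt 𝓕)

  ----------------------------------------------------------------------
  -- Existence of the limit: expAt 𝓕 is nondecreasing.

  private
    ¬¬maximum : ∀ {P : Pred ℕ 0ℓ} b → (∀ k → P k → k ℕ.≤ b) →
                ∀ {m} → P m → ¬ ¬ ∃ (IsMaximum P)
    ¬¬maximum {P} b bounded {m} Pm = go b m Pm (ℕ.m≤m+n b m)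
      where
      go : ∀ d m → P m → b ℕ.≤ d ℕ.+ m → ¬ ¬ ∃ (IsMaximum P)
      go zero    m Pm b≤m   ¬max = ¬max (m , Pm , λ k Pk → ℕ.≤-trans (bounded k Pk) b≤m)
      go (suc d) m Pm b≤d+m ¬max = ¬max (m , Pm , λ k Pk → ℕ.≮⇒≥ λ m<k →
        go d k Pk (ℕ.≤-trans b≤d+m (ℕ.≤-trans (ℕ.≤-reflexive (≡.sym (ℕ.+-suc d m))) (ℕ.+-monoʳ-≤ d m<k))) ¬max)

    edgeCount-bounded : ∀ {C 𝓕} k → IsEdgeCount n C 𝓕 k → k ℕ.≤ length (vertexPairs n)
    edgeCount-bounded {n} k (G , _ , _ , ≡.refl) = length-filter _ (vertexPairs n)

    IsEdgeCount-mono : ∀ {C D 𝓕} → C ≤⁺ D → ∀ {m} → IsEdgeCount n C 𝓕 m → IsEdgeCount n D 𝓕 m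
    IsEdgeCount-mono {n} {C} {D} C≤D (G , free , (p , α , (0≤p , p≤1) , 0≤α , α≤C , jumbled) , ≡.refl) =
      G , free , (p , α , (0≤p , p≤1) , 0≤α
        , ≤-trans α≤C (*-monoʳ-≤ {proj₁ C} {proj₁ D} (√-nonneg (fromℕ n * p) 0≤np) C≤D)
        , jumbled) , ≡.refl
      where
      0≤np : 0# ≤ fromℕ n * p
      0≤np np<0 = *-monoʳ-≤ 0≤p (0≤fromℕ n)
        (<-respʳ (CommutativeRing.sym commutativeRing (zeroˡ p)) np<0)

    log-mono-/ : ∀ n a b → a ℕ.≤ b →
                 log (suc a /⁺ (2 ℕ.+ n)) ÷ log⁺ n ≤ log (suc b /⁺ (2 ℕ.+ n)) ÷ log⁺ n
    log-mono-/ n a b a≤b = [ less , (λ { ≡.refl → ≤-refl }) ]′ (ℕ.m≤n⇒m<n∨m≡n a≤b)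
      where
      less : a ℕ.< b → log (suc a /⁺ (2 ℕ.+ n)) ÷ log⁺ n ≤ log (suc b /⁺ (2 ℕ.+ n)) ÷ log⁺ n
      less a<b = <⇒≤ (÷-mono-< (log⁺ n) (log-mono-< (suc a /⁺ (2 ℕ.+ n)) (suc b /⁺ (2 ℕ.+ n))
        (÷-mono-< (fromℕ⁺ (2 ℕ.+ n)) (fromℕ-mono-< {suc a} {suc b} (ℕ.s≤s a<b)))))

    logRatio-mono : ∀ n m {q r} → q < r →
                    ¬ ¬ (∃[ m′ ] (m ℕ.≤ m′ × logRatio n m′ ≺ q)) → logRatio n m ≺ r
    logRatio-mono 0             m       q<r _     = tt
    logRatio-mono 1             m       q<r _     = tt
    logRatio-mono (suc (suc n)) 0       q<r _     = tt
    logRatio-mono (suc (suc n)) (suc a) q<r ¬¬m′ = ≤-<-trans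
      (λ q<x → ¬¬m′ λ { (suc b , a≤b , y<q) →
        log-mono-/ n a b (ℕ.s≤s⁻¹ a≤b) (<-trans y<q q<x) }) q<r

    term-mono : ∀ 𝓕 {C D} → C ≤⁺ D → ∀ n → term C 𝓕 n ≼ term D 𝓕 n
    term-mono 𝓕 {C} {D} C≤D n r (q , q<r , bound) =
      let s , q<s , s<r = dense q<r in
      s , s<r , λ (m , Pm , _) → logRatio-mono n m q<s λ none →
        ¬¬maximum _ (edgeCount-bounded {C = D} {𝓕}) (IsEdgeCount-mono {C = C} {D} {𝓕} C≤D Pm)
          λ (m′ , max@(_ , m′-upper)) →
            none (m′ , m′-upper m (IsEdgeCount-mono {C = C} {D} {𝓕} C≤D Pm) , bound (m′ , max))

    expAt-mono : ∀ 𝓕 {C D} → C ≤⁺ D → expAt 𝓕 C ≼ expAt 𝓕 D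
    expAt-mono 𝓕 {C} {D} C≤D r (N , q , q<r , bound) =
      N , q , q<r , λ (n , N≤n) → term-mono 𝓕 {C} {D} C≤D n q (bound (n , N≤n))

  exp-isLimit : ∀ 𝓕 → exp 𝓕 ≼ liminf _≤⁺_ (expAt 𝓕) × liminf _≤⁺_ (expAt 𝓕) ≼ exp 𝓕
  exp-isLimit 𝓕 = upper , lower
    where
    upper : exp 𝓕 ≼ liminf _≤⁺_ (expAt 𝓕)
    upper r (q , q<r , cofinal) = (1# , 0<1) , q , q<r , λ (C , _) →
      let (D , C≤D) , D≺q = cofinal C in expAt-mono 𝓕 {C} {D} C≤D q D≺q

    lower : liminf _≤⁺_ (expAt 𝓕) ≼ exp 𝓕
    lower r (C@(c , 0<c) , q , q<r , bound) = q , q<r , λ (d , 0<d) →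
      let c≤c⊔d , d≤c⊔d , _ = ⊔-supremum c d
          c⊔d = c ⊔ d , <-≤-trans 0<c c≤c⊔d
      in (c⊔d , d≤c⊔d) , bound (c⊔d , c≤c⊔d)

{-# OPTIONS --safe #-}
module Submission where

-- Let G be jumbled with density p ≥ 1 / b, where b is a small multiple of n^(1/3).  For
-- every vertex set S, the set of vertices with fewer than |S| / 2b neighbours in S
-- spans too few edges with S, hence it has at most O(n b / |S|) elements.  Reserve a
-- part of size n / 10 for each vertex of the Petersen graph, which is labelled so that
--
--   x₁ ~ x, b₁, b₂    x₂ ~ x, c₁, c₂    y ~ x, y₁, y₂
--   b₁ ~ y₁, c₁       b₂ ~ y₂, c₂       y₁ ~ c₂       y₂ ~ c₁
--
-- First choose x₁ and x₂ such that the candidates for b₁, b₂ in N(x₁) and for c₁, c₂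
-- in N(x₂) number about n^(2/3), and the common neighbours x about n^(1/3).  A typical c₁
-- has about n^(1/3) neighbours b₁, and these are adjacent to most of the part of y₁;
-- likewise for c₂ and y₂.  Averaging over (c₁ , c₂) yields a pair such that n^(2/3)
-- neighbours y₁ of c₂ are reached from c₁, and n^(2/3) neighbours y₂ of c₁ from c₂.
-- Almost every y then has a neighbour among these y₁, these y₂ and the x.
--
-- So a Petersen-free graph has p = O(n^(-1/3)), and O(n^(5/3)) edges.

open import Defs
import Algebra.Properties.Ring as RingProperties
import Algebra.Properties.Semiring.Mult as SemiringMult
import Algebra.Solver.Ring.NaturalCoefficients.Default as RingSolver
open import Algebra.Bundles using (CommutativeRing)
open import Data.Bool.Base using (Bool; true; false; not; _∧_; _∨_; if_then_else_; T)
import Data.Bool.Properties as Bool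
open import Data.Bool.ListAction using (any)
open import Data.Fin.Base as Fin using (Fin; zero; suc; toℕ)
import Data.Fin.Properties as Fin
open import Data.Fin.Patterns
open import Data.Fin.Subset using (Subset; ∣_∣; ⊤; inside)
import Data.Fin.Subset.Properties as Subset
import Data.List.Base as List hiding (sum)
open List using (List; []; _∷_)
import Data.List.Properties as List using (map-cong; map-++; map-tabulate)
open import Data.List.Relation.Unary.All as All using (All; []; _∷_)
import Data.List.Relation.Unary.Any.Properties as Any
open import Data.Nat.Base as ℕ using (ℕ; zero; suc; NonZero; nonZero; _^_)
import Data.Nat.DivMod as ℕ
import Data.Nat.ListAction as List
import Data.Nat.ListAction.Properties as List
import Data.Nat.Properties as ℕ
open import Data.Nat.Tactic.RingSolver using (solve-∀)
open import Data.Product.Base using (∃; ∃-syntax; _×_; _,_; proj₁; proj₂)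
open import Data.Sum.Base using (inj₁; inj₂)
open import Data.Unit.Base using (tt)
import Data.Vec.Base as Vec
import Data.Vec.Properties as Vec
open import Function.Base using (_∘_; id)
open import Function.Bundles using (Equivalence)
open import Level using (0ℓ)
open import Relation.Binary.PropositionalEquality as ≡ using (_≡_)
import Relation.Binary.Reasoning.Base.Triple as TripleReasoning
open import Relation.Binary.Structures using (IsPreorder)
open import Relation.Nullary.Decidable using (yes; no; does; from-yes; decidable-stable)
open import Relation.Nullary.Negation using (¬_; contradiction)
open import Relation.Unary using (Pred; Decidable; ｛_｝)

module Combinatorics where
  open import Algebra.Properties.Semiring.Sum ℕ.+-*-semiring
    using (sum; sum-syntax; ∑-comm; ∑-distrib-+; sum-cong-≗; *-distribˡ-sum; *-distribʳ-sum)
  open import Data.Nat.Base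
  open import Data.Nat.DivMod
  open import Data.Nat.Properties
  open import Relation.Binary.PropositionalEquality

  private variable
    n : ℕ

  VertexSet : ℕ → Set
  VertexSet n = Fin n → Bool

  χ : Bool → ℕ
  χ true  = 1
  χ false = 0

  opaque
    card : VertexSet n → ℕ
    card S = sum (χ ∘ S)

  infixl 7 _∩_ _∖_

  _∩_ _∖_ : VertexSet n → VertexSet n → VertexSet n
  (S ∩ T) i = S i ∧ T i
  (S ∖ T) i = S i ∧ not (T i)

  sum-mono-≤ : {f g : Fin n → ℕ} → (∀ i → f i ≤ g i) → sum f ≤ sum g
  sum-mono-≤ {zero}  f≤g = z≤n
  sum-mono-≤ {suc n} f≤g = +-mono-≤ (f≤g zero) (sum-mono-≤ (f≤g ∘ suc))

  opaque
    unfolding card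

    card≤card∖+card : (S T : VertexSet n) → card S ≤ card (S ∖ T) + card T
    card≤card∖+card S T = ≤-trans (sum-mono-≤ λ i → pointwise (S i) (T i))
      (≤-reflexive (∑-distrib-+ (χ ∘ (S ∖ T)) (χ ∘ T)))
      where
      pointwise : ∀ s t → χ s ≤ χ (s ∧ not t) + χ t
      pointwise false t     = z≤n
      pointwise true  false = ≤-refl
      pointwise true  true  = ≤-refl

    card>0⇒nonempty : (S : VertexSet n) → 0 < card S → ∃[ i ] S i ≡ true
    card>0⇒nonempty {suc n} S 0<S with S zero in S0
    ... | true  = zero , S0
    ... | false with card>0⇒nonempty (S ∘ suc) 0<S
    ...   | i , Si = suc i , Si

  ∈∩ : (S T : VertexSet n) {i : Fin n} → (S ∩ T) i ≡ true → S i ≡ true × T i ≡ true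
  ∈∩ S T {i} h with true ← S i | true ← T i = refl , refl

  ∈∖ : (S T : VertexSet n) {i : Fin n} → (S ∖ T) i ≡ true → S i ≡ true × T i ≡ false
  ∈∖ S T {i} h with true ← S i | false ← T i = refl , refl

  outside-three : (S A B C : VertexSet n) → card A + card B + card C < card S →
                  ∃[ i ] (S i ≡ true × A i ≡ false × B i ≡ false × C i ≡ false)
  outside-three S A B C small =
    let i , h = card>0⇒nonempty (S ∖ A ∖ B ∖ C) (+-cancelʳ-< (card A + card B + card C) _ _ (<-≤-trans small bound))
        h₁ , c = ∈∖ (S ∖ A ∖ B) C h
        h₂ , b = ∈∖ (S ∖ A) B h₁
        s , a  = ∈∖ S A h₂
    in i , s , a , b , c
    where
    rearrange : ∀ d a b c → d + c + b + a ≡ d + (a + b + c)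
    rearrange = solve-∀
    bound : card S ≤ card (S ∖ A ∖ B ∖ C) + (card A + card B + card C)
    bound = begin
      card S                                                     ≤⟨ card≤card∖+card S A ⟩
      card (S ∖ A) + card A                                      ≤⟨ +-monoˡ-≤ _ (card≤card∖+card (S ∖ A) B) ⟩
      card (S ∖ A ∖ B) + card B + card A
        ≤⟨ +-monoˡ-≤ _ (+-monoˡ-≤ _ (card≤card∖+card (S ∖ A ∖ B) C)) ⟩
      card (S ∖ A ∖ B ∖ C) + card C + card B + card A
        ≡⟨ rearrange (card (S ∖ A ∖ B ∖ C)) (card A) (card B) (card C) ⟩
      card (S ∖ A ∖ B ∖ C) + (card A + card B + card C)          ∎
      where open ≤-Reasoning

  opaque
    unfolding card

    ∣tabulate∣≡card : (S : VertexSet n) → ∣ Vec.tabulate S ∣ ≡ card S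
    ∣tabulate∣≡card {zero}  S = refl
    ∣tabulate∣≡card {suc n} S with S zero
    ... | true  = cong suc (∣tabulate∣≡card (S ∘ suc))
    ... | false = ∣tabulate∣≡card (S ∘ suc)

  sum-filter : ∀ {A : Set} {P : Pred A 0ℓ} (P? : Decidable P) (w : A → ℕ) xs →
               List.sum (List.map w (List.filter P? xs)) ≡ List.sum (List.map (λ x → if does (P? x) then w x else 0) xs)
  sum-filter P? w [] = refl
  sum-filter P? w (x ∷ xs) with does (P? x)
  ... | true  = cong (w x +_) (sum-filter P? w xs)
  ... | false = sum-filter P? w xs

  sum-tabulate : ∀ {A : Set} (w : A → ℕ) (f : Fin n → A) →
                 List.sum (List.map w (List.tabulate f)) ≡ sum (w ∘ f)
  sum-tabulate {zero}  w f = refl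
  sum-tabulate {suc n} w f = cong (w (f zero) +_) (sum-tabulate w (f ∘ suc))

  sum-cartesianProduct : ∀ {m} {A B : Set} (w : A × B → ℕ) (f : Fin m → A) (g : Fin n → B) →
    List.sum (List.map w (List.cartesianProduct (List.tabulate f) (List.tabulate g))) ≡
    ∑[ i < m ] ∑[ j < n ] w (f i , g j)
  sum-cartesianProduct {m = zero} w f g = refl
  sum-cartesianProduct {m = suc m} {A} {B} w f g = begin
    List.sum (List.map w (row List.++ rest))                            ≡⟨ cong List.sum (List.map-++ w row rest) ⟩
    List.sum (List.map w row List.++ List.map w rest)
      ≡⟨ List.sum-++ (List.map w row) (List.map w rest) ⟩
    List.sum (List.map w row) + List.sum (List.map w rest)
      ≡⟨ cong₂ _+_
           (trans (cong (List.sum ∘ List.map w) (List.map-tabulate g (f zero ,_))) (sum-tabulate w ((f zero ,_) ∘ g)))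
           (sum-cartesianProduct w (f ∘ suc) g) ⟩
    _                                                                   ∎
    where
    open ≡-Reasoning
    row rest : List (A × B)
    row  = List.map (f zero ,_) (List.tabulate g)
    rest = List.cartesianProduct (List.tabulate (f ∘ suc)) (List.tabulate g)

  opaque
    unfolding card

    e≤∑deg : (G : Graph n) (X Y : VertexSet n) →
             e G (Vec.tabulate X) (Vec.tabulate Y) ≤ ∑[ i < n ] (χ (X i) * card (Y ∩ adjacent G i))
    e≤∑deg {n} G X Y = begin
      e G X′ Y′                                          ≡⟨ sum-filter _ (weight X′ Y′) (vertexPairs n) ⟩
      List.sum (List.map w (vertexPairs n))              ≡⟨ sum-cartesianProduct w id id ⟩
      ∑[ i < n ] ∑[ j < n ] w (i , j)
        ≤⟨ sum-mono-≤ (λ i → sum-mono-≤ λ j → pointwise i j) ⟩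
      ∑[ i < n ] ∑[ j < n ] (up i j * t i j + up i j * t j i)
        ≡⟨ sum-cong-≗ (λ i → ∑-distrib-+ (λ j → up i j * t i j) (λ j → up i j * t j i)) ⟩
      ∑[ i < n ] (∑[ j < n ] (up i j * t i j) + ∑[ j < n ] (up i j * t j i))
        ≡⟨ ∑-distrib-+ (λ i → ∑[ j < n ] (up i j * t i j)) (λ i → ∑[ j < n ] (up i j * t j i)) ⟩
      ∑[ i < n ] ∑[ j < n ] (up i j * t i j) + ∑[ i < n ] ∑[ j < n ] (up i j * t j i)
        ≡⟨ cong (∑[ i < n ] ∑[ j < n ] (up i j * t i j) +_) (∑-comm (λ i j → up i j * t j i)) ⟩
      ∑[ i < n ] ∑[ j < n ] (up i j * t i j) + ∑[ i < n ] ∑[ j < n ] (up j i * t i j)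
        ≡⟨ ∑-distrib-+ (λ i → ∑[ j < n ] (up i j * t i j)) (λ i → ∑[ j < n ] (up j i * t i j)) ⟨
      ∑[ i < n ] (∑[ j < n ] (up i j * t i j) + ∑[ j < n ] (up j i * t i j))
        ≡⟨ sum-cong-≗ (λ i → ∑-distrib-+ (λ j → up i j * t i j) (λ j → up j i * t i j)) ⟨
      ∑[ i < n ] ∑[ j < n ] (up i j * t i j + up j i * t i j) ≤⟨ sum-mono-≤ (λ i → sum-mono-≤ λ j → exclusive i j) ⟩
      ∑[ i < n ] ∑[ j < n ] t i j
        ≡⟨ sum-cong-≗ (λ i → *-distribˡ-sum (χ (X i)) (λ j → χ (Y j ∧ adjacent G i j))) ⟨
      ∑[ i < n ] (χ (X i) * card (Y ∩ adjacent G i))     ∎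
      where
      open ≤-Reasoning
      X′ Y′ : Subset n
      X′ = Vec.tabulate X
      Y′ = Vec.tabulate Y
      w : Fin n × Fin n → ℕ
      w (i , j) = if does (i Fin.<? j) ∧ does (adjacent G i j Bool.≟ true) then weight X′ Y′ (i , j) else 0
      up t : Fin n → Fin n → ℕ
      up i j = χ (does (i Fin.<? j))
      t i j = χ (X i) * χ (Y j ∧ adjacent G i j)

      counts : ∀ xi xj yi yj → (if (xi ∧ yi) ∧ (xj ∧ yj) then 2 else if (xi ∧ yj) ∨ (xj ∧ yi) then 1 else 0)
               ≤ 1 * (χ xi * χ (yj ∧ true)) + 1 * (χ xj * χ (yi ∧ true))
      counts false false yi yj = z≤n
      counts false true false yj = z≤n
      counts false true true yj = ≤-refl
      counts true false false false = z≤n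
      counts true false false true = ≤-refl
      counts true false true false = z≤n
      counts true false true true = ≤-refl
      counts true true false false = z≤n
      counts true true false true = ≤-refl
      counts true true true false = ≤-refl
      counts true true true true = ≤-refl

      pointwise : ∀ i j → w (i , j) ≤ up i j * t i j + up i j * t j i
      pointwise i j with does (i Fin.<? j)
      ... | false = z≤n
      ... | true rewrite Graph.sym G j i with adjacent G i j
      ...   | false = z≤n
      ...   | true rewrite Vec.lookup∘tabulate X i | Vec.lookup∘tabulate X j
                         | Vec.lookup∘tabulate Y i | Vec.lookup∘tabulate Y j = counts (X i) (X j) (Y i) (Y j)

      exclusive : ∀ i j → up i j * t i j + up j i * t i j ≤ t i j
      exclusive i j with toℕ i <ᵇ toℕ j in i<j | toℕ j <ᵇ toℕ i in j<i
      ... | true  | true  = contradiction (<ᵇ⇒< _ _ (subst T (sym j<i) _)) (<-asym (<ᵇ⇒< (toℕ i) _ (subst T (sym i<j) _)))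
      ... | true  | false = ≤-reflexive (trans (+-identityʳ _) (*-identityˡ _))
      ... | false | true  = ≤-reflexive (*-identityˡ _)
      ... | false | false = z≤n

  -- Averaging over the pairs (x , y) ∈ X × Y: at most half of them are bad.
  opaque
    unfolding card

    pair-outside : (X Y : VertexSet n) (R S : Fin n → VertexSet n) → 0 < card X → 0 < card Y →
      (∀ x → X x ≡ true → 4 * card (R x) ≤ card Y) →
      (∀ y → Y y ≡ true → 4 * card (S y) ≤ card X) →
      ¬ (∀ x y → X x ≡ true → Y y ≡ true → R x y ≡ false → S y x ≡ true)
    pair-outside {n} X Y R S 0<X 0<Y R-small S-small bad = <⇒≱ 2ab<4ab total
      where
      open ≤-Reasoning
      a b : ℕ
      a = card X
      b = card Y
      instance
        ab≢0 : NonZero (a * b)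
        ab≢0 = m*n≢0 a b {{>-nonZero 0<X}} {{>-nonZero 0<Y}}

      2ab<4ab : 2 * (a * b) < 4 * (a * b)
      2ab<4ab = *-monoˡ-< (a * b) {2} {4} (s≤s (s≤s (s≤s z≤n)))

      r s : Fin n → Fin n → ℕ
      r x y = χ (X x) * χ (R x y)
      s x y = χ (Y y) * (χ (X x) * χ (S y x))

      covered : ∀ x y → χ (X x) * χ (Y y) ≤ r x y + s x y
      covered x y with X x in Xx | Y y in Yy | R x y in Rxy
      ... | false | _     | _     = z≤n
      ... | true  | false | _     = z≤n
      ... | true  | true  | true  = s≤s z≤n
      ... | true  | true  | false rewrite bad x y Xx Yy Rxy = s≤s z≤n

      χ*χ≤χ : ∀ p q → χ p * χ q ≤ χ q
      χ*χ≤χ false q = z≤n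
      χ*χ≤χ true  q = ≤-reflexive (+-identityʳ (χ q))

      weigh : ∀ p {m k} → (p ≡ true → m ≤ k) → χ p * m ≤ χ p * k
      weigh false m≤k = z≤n
      weigh true  m≤k = +-monoˡ-≤ 0 (m≤k refl)

      swap-4 : ∀ p q → 4 * (p * q) ≡ p * (4 * q)
      swap-4 = solve-∀

      few : ∀ (A B : VertexSet n) (Q : Fin n → VertexSet n) → (∀ x → A x ≡ true → 4 * card (Q x) ≤ card B) →
            4 * ∑[ x < n ] (χ (A x) * card (Q x)) ≤ card A * card B
      few A B Q small = begin
        4 * ∑[ x < n ] (χ (A x) * card (Q x))    ≡⟨ *-distribˡ-sum 4 (λ x → χ (A x) * card (Q x)) ⟩
        ∑[ x < n ] (4 * (χ (A x) * card (Q x)))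
          ≤⟨ sum-mono-≤ (λ x → ≤-trans (≤-reflexive (swap-4 (χ (A x)) (card (Q x)))) (weigh (A x) (small x))) ⟩
        ∑[ x < n ] (χ (A x) * card B)            ≡⟨ *-distribʳ-sum (card B) (χ ∘ A) ⟨
        card A * card B                          ∎

      few-R : 4 * ∑[ x < n ] ∑[ y < n ] r x y ≤ a * b
      few-R = ≤-trans (≤-reflexive (cong (4 *_) (sum-cong-≗ λ x → sym (*-distribˡ-sum (χ (X x)) (χ ∘ R x))))) (few X Y R R-small)

      few-S : 4 * ∑[ x < n ] ∑[ y < n ] s x y ≤ a * b
      few-S = begin
        4 * ∑[ x < n ] ∑[ y < n ] s x y                                      ≡⟨ cong (4 *_) (∑-comm s) ⟩
        4 * ∑[ y < n ] ∑[ x < n ] s x y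
          ≡⟨ cong (4 *_) (sum-cong-≗ λ y → *-distribˡ-sum (χ (Y y)) (λ x → χ (X x) * χ (S y x))) ⟨
        4 * ∑[ y < n ] (χ (Y y) * ∑[ x < n ] (χ (X x) * χ (S y x)))
          ≤⟨ *-monoʳ-≤ 4 (sum-mono-≤ λ y → *-monoʳ-≤ (χ (Y y)) (sum-mono-≤ λ x → χ*χ≤χ (X x) (S y x))) ⟩
        4 * ∑[ y < n ] (χ (Y y) * card (S y))                                ≤⟨ few Y X S S-small ⟩
        b * a                                                                ≡⟨ *-comm b a ⟩
        a * b                                                                ∎

      total : 4 * (a * b) ≤ 2 * (a * b)
      total = begin
        4 * (a * b)
          ≡⟨ cong (4 *_) (*-distribʳ-sum b (χ ∘ X)) ⟩
        4 * ∑[ x < n ] (χ (X x) * b)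
          ≡⟨ cong (4 *_) (sum-cong-≗ λ x → *-distribˡ-sum (χ (X x)) (χ ∘ Y)) ⟩
        4 * ∑[ x < n ] ∑[ y < n ] (χ (X x) * χ (Y y))
          ≤⟨ *-monoʳ-≤ 4 (sum-mono-≤ λ x → sum-mono-≤ λ y → covered x y) ⟩
        4 * ∑[ x < n ] ∑[ y < n ] (r x y + s x y)
          ≡⟨ cong (4 *_) (sum-cong-≗ λ x → ∑-distrib-+ (r x) (s x)) ⟩
        4 * ∑[ x < n ] (∑[ y < n ] r x y + ∑[ y < n ] s x y)
          ≡⟨ cong (4 *_) (∑-distrib-+ (λ x → ∑[ y < n ] r x y) (λ x → ∑[ y < n ] s x y)) ⟩
        4 * (∑[ x < n ] ∑[ y < n ] r x y + ∑[ x < n ] ∑[ y < n ] s x y)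
          ≡⟨ *-distribˡ-+ 4 (∑[ x < n ] ∑[ y < n ] r x y) _ ⟩
        4 * ∑[ x < n ] ∑[ y < n ] r x y + 4 * ∑[ x < n ] ∑[ y < n ] s x y    ≤⟨ +-mono-≤ few-R few-S ⟩
        a * b + a * b
          ≡⟨ cong (a * b +_) (+-identityʳ (a * b)) ⟨
        2 * (a * b)                                                          ∎

  opaque
    unfolding card

    -- The i-th vertex of the Petersen graph is sought in the i-th residue class modulo 10,
    -- which makes the embedding injective.
    class : Fin 10 → VertexSet n
    class i x = (toℕ x % 10) ≡ᵇ toℕ i

    class-injective : ∀ i j (x : Fin n) → class i x ≡ true → class j x ≡ true → i ≡ j
    class-injective i j x xi xj = Fin.toℕ-injective (trans (sym (≡ᵇ⇒≡ (toℕ x % 10) _ (subst T (sym xi) _))) (≡ᵇ⇒≡ (toℕ x % 10) _ (subst T (sym xj) _)))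

    card-class : ∀ (n : ℕ) (i : Fin 10) → n / 10 ≤ card {n} (class i)
    card-class n i = subst (λ m → n / 10 ≤ card {m} (class i))
      (trans (+-comm (n / 10 * 10) (n % 10)) (sym (m≡m%n+[m/n]*n n 10))) (count i (n / 10) (n % 10))
      where
      step : ∀ (i : Fin 10) m → card {10 + m} (class i) ≡ suc (card {m} (class i))
      step 0F m = refl
      step 1F m = refl
      step 2F m = refl
      step 3F m = refl
      step 4F m = refl
      step 5F m = refl
      step 6F m = refl
      step 7F m = refl
      step 8F m = refl
      step 9F m = refl

      count : ∀ i q r → q ≤ card {q * 10 + r} (class i)
      count i zero    r = z≤n
      count i (suc q) r = ≤-trans (s≤s (count i q r)) (≤-reflexive (sym (step i (q * 10 + r))))

  petersenEdges : List (Fin 10 × Fin 10)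
  petersenEdges =
    (0F , 9F) ∷ (0F , 8F) ∷ (0F , 7F) ∷ (1F , 9F) ∷ (1F , 5F) ∷
    (1F , 6F) ∷ (4F , 9F) ∷ (4F , 2F) ∷ (4F , 3F) ∷ (6F , 2F) ∷
    (5F , 3F) ∷ (2F , 8F) ∷ (3F , 7F) ∷ (5F , 8F) ∷ (6F , 7F) ∷ []

  _joins_,_ : Fin 10 × Fin 10 → Fin 10 → Fin 10 → Bool
  (k , l) joins i , j = ((toℕ k ≡ᵇ toℕ i) ∧ (toℕ l ≡ᵇ toℕ j)) ∨ ((toℕ k ≡ᵇ toℕ j) ∧ (toℕ l ≡ᵇ toℕ i))

  petersenEdges-complete : ∀ i j → adjacent petersen i j ≡ any (_joins i , j) petersenEdges
  petersenEdges-complete = from-yes (Fin.all? λ i → Fin.all? λ j →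
    adjacent petersen i j Bool.≟ any (_joins i , j) petersenEdges)

  petersen-subgraph : ∀ {n} (G : Graph n) (f : Fin 10 → Fin n) → (∀ i → class i (f i) ≡ true) →
    All (λ (i , j) → adjacent G (f i) (f j) ≡ true) petersenEdges → petersen IsSubgraphOf G
  petersen-subgraph G f f∈class f-edges = f , injective , preserves
    where
    injective : ∀ {i j} → f i ≡ f j → i ≡ j
    injective {i} {j} fi≡fj = class-injective i j (f i) (f∈class i) (trans (cong (class j) fi≡fj) (f∈class j))

    ≡ᵇ-toℕ : ∀ {i j : Fin 10} → T (toℕ i ≡ᵇ toℕ j) → i ≡ j
    ≡ᵇ-toℕ {i} {j} = Fin.toℕ-injective ∘ ≡ᵇ⇒≡ (toℕ i) (toℕ j)

    joined : ∀ k l {i j} → adjacent G (f k) (f l) ≡ true → T ((k , l) joins i , j) → adjacent G (f i) (f j) ≡ true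
    joined k l {i} {j} kl t with Equivalence.to (Bool.T-∨ {(toℕ k ≡ᵇ toℕ i) ∧ (toℕ l ≡ᵇ toℕ j)}) t
    ... | inj₁ t′ with Equivalence.to (Bool.T-∧ {toℕ k ≡ᵇ toℕ i}) t′
    ...   | ki , lj with refl ← ≡ᵇ-toℕ {k} {i} ki | refl ← ≡ᵇ-toℕ {l} {j} lj = kl
    joined k l {i} {j} kl t | inj₂ t′ with Equivalence.to (Bool.T-∧ {toℕ k ≡ᵇ toℕ j}) t′
    ...   | kj , li with refl ← ≡ᵇ-toℕ {k} {j} kj | refl ← ≡ᵇ-toℕ {l} {i} li = trans (Graph.sym G (f l) (f k)) kl

    preserves : ∀ i j → adjacent petersen i j ≡ true → adjacent G (f i) (f j) ≡ true
    preserves i j ij =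
      let (kl , t) = All.lookupAny f-edges (Any.any⁻ (_joins i , j) petersenEdges
                       (subst T (trans (sym ij) (petersenEdges-complete i j)) _))
      in joined _ _ kl t

  -- 1 / b is a lower bound for the density p, and spread says that two sets spanning
  -- less than half of the expected number of edges cannot both be large.
  module Embedding {n} (G : Graph n) (b M : ℕ) .{{_ : NonZero b}} .{{_ : NonZero (n / 10)}}
    (spread : ∀ X Y → 2 * b * e G X Y ≤ ∣ X ∣ * ∣ Y ∣ → ∣ X ∣ * ∣ Y ∣ ≤ M)
    (large : 128 * (b * b) * M ≤ (n / 10) * (n / 10)) where

    open ≤-Reasoning

    s : ℕ
    s = n / 10

    N : Fin n → VertexSet n
    N = adjacent G

    V : Fin 10 → VertexSet n
    V = class

    opaque
      unfolding card

      low : VertexSet n → VertexSet n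
      low S x = 2 * b * card (S ∩ N x) <ᵇ card S

      low⇒< : ∀ S x → low S x ≡ true → 2 * b * card (S ∩ N x) < card S
      low⇒< S x l = <ᵇ⇒< _ _ (subst T (sym l) _)

      ¬low⇒≤ : ∀ S x → low S x ≡ false → card S ≤ 2 * b * card (S ∩ N x)
      ¬low⇒≤ S x l = ≮⇒≥ λ lt → subst T l (<⇒<ᵇ lt)

      card-low : ∀ S → card (low S) * card S ≤ M
      card-low S = begin
        card (low S) * card S                      ≡⟨ cards ⟨
        ∣ Vec.tabulate (low S) ∣ * ∣ Vec.tabulate S ∣ ≤⟨ spread (Vec.tabulate (low S)) (Vec.tabulate S) few ⟩
        M                                          ∎
        where
        cards : ∣ Vec.tabulate (low S) ∣ * ∣ Vec.tabulate S ∣ ≡ card (low S) * card S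
        cards = cong₂ _*_ (∣tabulate∣≡card (low S)) (∣tabulate∣≡card S)

        swap : ∀ k p q → k * (p * q) ≡ p * (k * q)
        swap = solve-∀

        pointwise : ∀ x → 2 * b * (χ (low S x) * card (S ∩ N x)) ≤ χ (low S x) * card S
        pointwise x = ≤-trans (≤-reflexive (swap (2 * b) (χ (low S x)) (card (S ∩ N x)))) scaled
          where
          scaled : χ (low S x) * (2 * b * card (S ∩ N x)) ≤ χ (low S x) * card S
          scaled with low S x in l
          ... | false = z≤n
          ... | true  = +-monoˡ-≤ 0 (<⇒≤ (low⇒< S x l))

        few : 2 * b * e G (Vec.tabulate (low S)) (Vec.tabulate S) ≤ ∣ Vec.tabulate (low S) ∣ * ∣ Vec.tabulate S ∣
        few = begin
          2 * b * e G (Vec.tabulate (low S)) (Vec.tabulate S)      ≤⟨ *-monoʳ-≤ (2 * b) (e≤∑deg G (low S) S) ⟩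
          2 * b * ∑[ x < n ] (χ (low S x) * card (S ∩ N x))
            ≡⟨ *-distribˡ-sum (2 * b) (λ x → χ (low S x) * card (S ∩ N x)) ⟩
          ∑[ x < n ] (2 * b * (χ (low S x) * card (S ∩ N x)))      ≤⟨ sum-mono-≤ pointwise ⟩
          ∑[ x < n ] (χ (low S x) * card S)                        ≡⟨ *-distribʳ-sum (card S) (χ ∘ low S) ⟨
          card (low S) * card S                                    ≡⟨ cards ⟨
          ∣ Vec.tabulate (low S) ∣ * ∣ Vec.tabulate S ∣            ∎

    opaque
      few-low : ∀ t (S : VertexSet n) → s ≤ 4 * b * t * card S → 32 * b * card (low S) ≤ t * s
      few-low t S s≤ = *-cancelʳ-≤ (32 * b * card (low S)) (t * s) s (begin
        32 * b * card (low S) * s                    ≤⟨ *-monoʳ-≤ (32 * b * card (low S)) s≤ ⟩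
        32 * b * card (low S) * (4 * b * t * card S) ≡⟨ regroup b (card (low S)) t (card S) ⟩
        t * (128 * (b * b) * (card (low S) * card S)) ≤⟨ *-monoʳ-≤ t (*-monoʳ-≤ (128 * (b * b)) (card-low S)) ⟩
        t * (128 * (b * b) * M)                      ≤⟨ *-monoʳ-≤ t large ⟩
        t * (s * s)                                  ≡⟨ *-assoc t s s ⟨
        t * s * s                                    ∎)
        where
        regroup : ∀ b l t c → 32 * b * l * (4 * b * t * c) ≡ t * (128 * (b * b) * (l * c))
        regroup = solve-∀

      few-low-b : ∀ (S : VertexSet n) → s ≤ 4 * b * b * card S → 32 * card (low S) ≤ s
      few-low-b S s≤ = *-cancelˡ-≤ {32 * card (low S)} {s} b (≤-trans (≤-reflexive (regroup b (card (low S)))) (few-low b S s≤))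
        where
        regroup : ∀ b l → b * (32 * l) ≡ 32 * b * l
        regroup = solve-∀

      few-low-1 : ∀ S (C : VertexSet n) → s ≤ 4 * b * card S → s ≤ 2 * b * card C → 16 * card (low S) ≤ card C
      few-low-1 S C s≤S s≤C = *-cancelˡ-≤ {16 * card (low S)} {card C} (2 * b) {{m*n≢0 2 b}} (begin
        2 * b * (16 * card (low S)) ≡⟨ regroup b (card (low S)) ⟩
        32 * b * card (low S)       ≤⟨ few-low 1 S (subst (λ k → s ≤ k * card S) (sym (*-identityʳ (4 * b))) s≤S) ⟩
        1 * s                       ≡⟨ *-identityˡ s ⟩
        s                           ≤⟨ s≤C ⟩
        2 * b * card C              ∎)
        where
        regroup : ∀ b l → 2 * b * (16 * l) ≡ 32 * b * l
        regroup = solve-∀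

      scale : ∀ {k k′} (S : VertexSet n) → k ≤ k′ → s ≤ k * card S → s ≤ k′ * card S
      scale S k≤k′ s≤ = ≤-trans s≤ (*-monoˡ-≤ (card S) k≤k′)

      nonempty : ∀ k (S : VertexSet n) → s ≤ k * card S → 0 < card S
      nonempty k S s≤ = n≢0⇒n>0 λ ∣S∣≡0 →
        <⇒≱ (>-nonZero⁻¹ s) (≤-trans s≤ (≤-reflexive (trans (cong (k *_) ∣S∣≡0) (*-zeroʳ k))))

      degree : ∀ k S {x} → low S x ≡ false → s ≤ k * card S → s ≤ k * (2 * b) * card (S ∩ N x)
      degree k S {x} ¬l s≤ = begin
        s                                ≤⟨ s≤ ⟩
        k * card S                       ≤⟨ *-monoʳ-≤ k (¬low⇒≤ S x ¬l) ⟩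
        k * (2 * b * card (S ∩ N x))     ≡⟨ *-assoc k (2 * b) (card (S ∩ N x)) ⟨
        k * (2 * b) * card (S ∩ N x)     ∎

      neighbour : ∀ k S {x} → low S x ≡ false → s ≤ k * card S → ∃[ y ] (S y ≡ true × N x y ≡ true)
      neighbour k S {x} ¬l s≤ =
        let y , h = card>0⇒nonempty (S ∩ N x) (nonempty (k * (2 * b)) (S ∩ N x) (degree k S ¬l s≤))
        in y , ∈∩ S (N x) h

      2b≤4b : 2 * b ≤ 4 * b
      2b≤4b = *-monoˡ-≤ b {2} {4} (s≤s (s≤s z≤n))

      4b≤4bb : 4 * b ≤ 4 * b * b
      4b≤4bb = m≤m*n (4 * b) b

      1≤4bb : 1 ≤ 4 * b * b
      1≤4bb = >-nonZero⁻¹ (4 * b * b) {{m*n≢0 (4 * b) b {{m*n≢0 4 b}}}}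

      choose : ∀ i A B C → s ≤ 4 * b * b * card A → s ≤ 4 * b * b * card B → s ≤ 4 * b * b * card C →
               ∃[ x ] (V i x ≡ true × low A x ≡ false × low B x ≡ false × low C x ≡ false)
      choose i A B C s≤A s≤B s≤C = outside-three (V i) (low A) (low B) (low C)
        (<-≤-trans (*-cancelˡ-< 32 (card (low A) + card (low B) + card (low C)) s (begin-strict
          32 * (card (low A) + card (low B) + card (low C))
            ≡⟨ distrib (card (low A)) (card (low B)) (card (low C)) ⟩
          32 * card (low A) + 32 * card (low B) + 32 * card (low C)
            ≤⟨ +-mono-≤ (+-mono-≤ (few-low-b A s≤A) (few-low-b B s≤B)) (few-low-b C s≤C) ⟩
          s + s + s                                                      ≡⟨ triple s ⟩
          3 * s
            <⟨ *-monoˡ-< s {3} {32} (s≤s (s≤s (s≤s (s≤s z≤n)))) ⟩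
          32 * s                                                         ∎)) (card-class n i))
        where
        distrib : ∀ a b c → 32 * (a + b + c) ≡ 32 * a + 32 * b + 32 * c
        distrib = solve-∀
        triple : ∀ s → s + s + s ≡ 3 * s
        triple = solve-∀

      s≤V : ∀ i → s ≤ 1 * card (V i)
      s≤V i = ≤-trans (card-class n i) (≤-reflexive (sym (+-identityʳ (card (V i)))))

      V-large : ∀ i → s ≤ 4 * b * b * card (V i)
      V-large i = scale (V i) 1≤4bb (s≤V i)

      most : ∀ A C → 16 * card (low A) ≤ card C → 15 * card C ≤ 16 * card (C ∖ low A)
      most A C small = +-cancelʳ-≤ (card C) (15 * card C) (16 * card (C ∖ low A)) (begin
        15 * card C + card C                           ≡⟨ step (card C) ⟩
        16 * card C                                    ≤⟨ *-monoʳ-≤ 16 (card≤card∖+card C (low A)) ⟩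
        16 * (card (C ∖ low A) + card (low A))         ≡⟨ *-distribˡ-+ 16 (card (C ∖ low A)) (card (low A)) ⟩
        16 * card (C ∖ low A) + 16 * card (low A)      ≤⟨ +-monoʳ-≤ (16 * card (C ∖ low A)) small ⟩
        16 * card (C ∖ low A) + card C                 ∎)
        where
        step : ∀ c → 15 * c + c ≡ 16 * c
        step = solve-∀

    -- If c has a neighbour in B, then every vertex of reach B i c is joined to c by a path
    -- of length 2 through B.
    reach : VertexSet n → Fin 10 → Fin n → VertexSet n
    reach B i c = V i ∖ low (B ∩ N c)

    module _ (B : VertexSet n) (s≤B : s ≤ 1 * (2 * b) * card B) (i : Fin 10) where

      opaque
        via-large : ∀ {c} → low B c ≡ false → s ≤ 4 * b * b * card (B ∩ N c)
        via-large {c} ¬l = subst (λ k → s ≤ k * card (B ∩ N c)) (regroup b) (degree (1 * (2 * b)) B ¬l s≤B)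
          where
          regroup : ∀ b → 1 * (2 * b) * (2 * b) ≡ 4 * b * b
          regroup = solve-∀

        reach-large : ∀ {c} → low B c ≡ false → s ≤ 2 * card (reach B i c)
        reach-large {c} ¬l = *-cancelˡ-≤ {s} {2 * card (reach B i c)} 15 (begin
          15 * s                             ≤⟨ *-monoʳ-≤ 15 (card-class n i) ⟩
          15 * card (V i)
            ≤⟨ most (B ∩ N c) (V i)
                (≤-trans (*-monoˡ-≤ (card (low (B ∩ N c))) {16} {32} (m≤m+n 16 16))
                (≤-trans (few-low-b (B ∩ N c) (via-large ¬l)) (card-class n i))) ⟩
          16 * card (reach B i c)            ≤⟨ *-monoˡ-≤ (card (reach B i c)) {16} {30} (m≤m+n 16 14) ⟩
          30 * card (reach B i c)            ≡⟨ regroup (card (reach B i c)) ⟩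
          15 * (2 * card (reach B i c))      ∎)
          where
          regroup : ∀ c → 30 * c ≡ 15 * (2 * c)
          regroup = solve-∀

        end-large : ∀ {c c′} → low B c ≡ false → low (reach B i c) c′ ≡ false → s ≤ 4 * b * b * card (reach B i c ∩ N c′)
        end-large {c} {c′} ¬l ¬l′ = scale (reach B i c ∩ N c′) 4b≤4bb
          (subst (λ k → s ≤ k * card (reach B i c ∩ N c′)) (regroup b) (degree 2 (reach B i c) ¬l′ (reach-large ¬l)))
          where
          regroup : ∀ b → 2 * (2 * b) ≡ 4 * b
          regroup = solve-∀

        few-low-reach : ∀ A (C : VertexSet n) {c} → s ≤ 4 * b * card A → s ≤ 2 * b * card C → low B c ≡ false →
                        4 * card (low (reach B i c)) ≤ card (C ∖ low A)
        few-low-reach A C {c} s≤A s≤C ¬l = *-cancelˡ-≤ {4 * card (low (reach B i c))} {card (C ∖ low A)} 16 (begin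
          16 * (4 * card (low (reach B i c)))   ≡⟨ regroup (card (low (reach B i c))) ⟩
          4 * (16 * card (low (reach B i c)))
            ≤⟨ *-monoʳ-≤ 4 (few-low-1 (reach B i c) C (scale (reach B i c) 2≤4b (reach-large ¬l)) s≤C) ⟩
          4 * card C                            ≤⟨ *-monoˡ-≤ (card C) {4} {15} (m≤m+n 4 11) ⟩
          15 * card C                           ≤⟨ most A C (few-low-1 A C s≤A s≤C) ⟩
          16 * card (C ∖ low A)                 ∎)
          where
          regroup : ∀ l → 16 * (4 * l) ≡ 4 * (16 * l)
          regroup = solve-∀
          2≤4b : 2 ≤ 4 * b
          2≤4b = ≤-trans (s≤s (s≤s z≤n)) (m≤m*n 4 b)

      route : ∀ {c c′ y} → low B c ≡ false → low (reach B i c) c′ ≡ false → low (reach B i c ∩ N c′) y ≡ false →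
              ∃[ y′ ] ∃[ b′ ] (V i y′ ≡ true × N y y′ ≡ true × N c′ y′ ≡ true ×
                               N y′ b′ ≡ true × N c b′ ≡ true × B b′ ≡ true)
      route {c} {c′} {y} ¬l ¬l′ ¬l″
        with y′ , y′∈Y , yy′ ← neighbour (4 * b * b) (reach B i c ∩ N c′) ¬l″ (end-large ¬l ¬l′)
        with y′∈reach , c′y′ ← ∈∩ (reach B i c) (N c′) y′∈Y
        with y′∈V , ¬l‴ ← ∈∖ (V i) (low (B ∩ N c)) y′∈reach
        with b′ , b′∈S , y′b′ ← neighbour (4 * b * b) (B ∩ N c) ¬l‴ (via-large ¬l)
        with b′∈B , cb′ ← ∈∩ B (N c) b′∈S
        = y′ , b′ , y′∈V , yy′ , c′y′ , y′b′ , cb′ , b′∈B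

    opaque
      rest-nonempty : ∀ A (C : VertexSet n) → s ≤ 4 * b * card A → s ≤ 2 * b * card C → 0 < card (C ∖ low A)
      rest-nonempty A C s≤A s≤C = *-cancelˡ-< 16 0 (card (C ∖ low A)) (begin-strict
        0                        <⟨ *-monoʳ-< 15 {0} {card C} (nonempty (2 * b) C s≤C) ⟩
        15 * card C              ≤⟨ most A C (few-low-1 A C s≤A s≤C) ⟩
        16 * card (C ∖ low A)    ∎)

    petersen-embeds : ¬ ¬ (petersen IsSubgraphOf G)
    petersen-embeds free with choose 0F (V 8F) (V 7F) (V 9F) (V-large 8F) (V-large 7F) (V-large 9F)
    ... | x₁ , x₁∈V , ¬l₈ , ¬l₇ , ¬l₉ with choose 1F (V 5F) (V 6F) (V 9F ∩ N x₁) (V-large 5F) (V-large 6F)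
           (scale (V 9F ∩ N x₁) (≤-trans (≤-reflexive (*-identityˡ (2 * b))) (≤-trans 2b≤4b 4b≤4bb)) (degree 1 (V 9F) ¬l₉ (s≤V 9F)))
    ...   | x₂ , x₂∈V , ¬l₅ , ¬l₆ , ¬lX = pair-outside C₁′ C₂′ R₁ R₂ C₁′>0 C₂′>0 R₁-few R₂-few finish
      where
      B₁ B₂ C₁ C₂ X₀ X C₁′ C₂′ : VertexSet n
      B₁ = V 8F ∩ N x₁
      B₂ = V 7F ∩ N x₁
      C₁ = V 5F ∩ N x₂
      C₂ = V 6F ∩ N x₂
      X₀ = V 9F ∩ N x₁
      X  = X₀ ∩ N x₂
      C₁′ = C₁ ∖ low B₁
      C₂′ = C₂ ∖ low B₂

      R₁ R₂ : Fin n → VertexSet n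
      R₁ c = low (reach B₁ 2F c)
      R₂ c = low (reach B₂ 3F c)

      s≤B₁ : s ≤ 1 * (2 * b) * card B₁
      s≤B₁ = degree 1 (V 8F) ¬l₈ (s≤V 8F)
      s≤B₂ : s ≤ 1 * (2 * b) * card B₂
      s≤B₂ = degree 1 (V 7F) ¬l₇ (s≤V 7F)

      1*2b≤2b : 1 * (2 * b) ≤ 2 * b
      1*2b≤2b = ≤-reflexive (*-identityˡ (2 * b))

      s≤B₁′ : s ≤ 4 * b * card B₁
      s≤B₁′ = scale B₁ (≤-trans 1*2b≤2b 2b≤4b) s≤B₁
      s≤B₂′ : s ≤ 4 * b * card B₂
      s≤B₂′ = scale B₂ (≤-trans 1*2b≤2b 2b≤4b) s≤B₂
      s≤C₁ : s ≤ 2 * b * card C₁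
      s≤C₁ = scale C₁ 1*2b≤2b (degree 1 (V 5F) ¬l₅ (s≤V 5F))
      s≤C₂ : s ≤ 2 * b * card C₂
      s≤C₂ = scale C₂ 1*2b≤2b (degree 1 (V 6F) ¬l₆ (s≤V 6F))

      s≤X : s ≤ 4 * b * b * card X
      s≤X = subst (λ k → s ≤ k * card X) (regroup b) (degree (1 * (2 * b)) X₀ ¬lX (degree 1 (V 9F) ¬l₉ (s≤V 9F)))
        where
        regroup : ∀ b → 1 * (2 * b) * (2 * b) ≡ 4 * b * b
        regroup = solve-∀

      C₁′>0 : 0 < card C₁′
      C₁′>0 = rest-nonempty B₁ C₁ s≤B₁′ s≤C₁
      C₂′>0 : 0 < card C₂′
      C₂′>0 = rest-nonempty B₂ C₂ s≤B₂′ s≤C₂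

      R₁-few : ∀ c → C₁′ c ≡ true → 4 * card (R₁ c) ≤ card C₂′
      R₁-few c c∈ = few-low-reach B₁ s≤B₁ 2F B₂ C₂ s≤B₂′ s≤C₂ (proj₂ (∈∖ C₁ (low B₁) c∈))
      R₂-few : ∀ c → C₂′ c ≡ true → 4 * card (R₂ c) ≤ card C₁′
      R₂-few c c∈ = few-low-reach B₂ s≤B₂ 3F B₁ C₁ s≤B₁′ s≤C₁ (proj₂ (∈∖ C₂ (low B₂) c∈))

      finish : ∀ c₁ c₂ → C₁′ c₁ ≡ true → C₂′ c₂ ≡ true → R₁ c₁ c₂ ≡ false → R₂ c₂ c₁ ≡ true
      finish c₁ c₂ c₁∈ c₂∈ ¬R₁ with R₂ c₂ c₁ in ¬R₂
      ... | true  = refl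
      ... | false
        with c₁∈C₁ , ¬lB₁ ← ∈∖ C₁ (low B₁) c₁∈ | c₂∈C₂ , ¬lB₂ ← ∈∖ C₂ (low B₂) c₂∈
        with c₁∈V , x₂c₁ ← ∈∩ (V 5F) (N x₂) c₁∈C₁ | c₂∈V , x₂c₂ ← ∈∩ (V 6F) (N x₂) c₂∈C₂
        with y , y∈V , ¬lY₁ , ¬lY₂ , ¬lX′ ← choose 4F (reach B₁ 2F c₁ ∩ N c₂) (reach B₂ 3F c₂ ∩ N c₁) X
               (end-large B₁ s≤B₁ 2F ¬lB₁ ¬R₁) (end-large B₂ s≤B₂ 3F ¬lB₂ ¬R₂) s≤X
        with x , x∈X , yx ← neighbour (4 * b * b) X ¬lX′ s≤X
        with x∈X₀ , x₂x ← ∈∩ X₀ (N x₂) x∈X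
        with x∈V , x₁x ← ∈∩ (V 9F) (N x₁) x∈X₀
        with y₁ , b₁ , y₁∈V , yy₁ , c₂y₁ , y₁b₁ , c₁b₁ , b₁∈B₁ ← route B₁ s≤B₁ 2F ¬lB₁ ¬R₁ ¬lY₁
        with y₂ , b₂ , y₂∈V , yy₂ , c₁y₂ , y₂b₂ , c₂b₂ , b₂∈B₂ ← route B₂ s≤B₂ 3F ¬lB₂ ¬R₂ ¬lY₂
        with b₁∈V , x₁b₁ ← ∈∩ (V 8F) (N x₁) b₁∈B₁ | b₂∈V , x₁b₂ ← ∈∩ (V 7F) (N x₁) b₂∈B₂
        = contradiction (petersen-subgraph G f f∈V
            (x₁x ∷ x₁b₁ ∷ x₁b₂ ∷ x₂x ∷ x₂c₁ ∷ x₂c₂ ∷ yx ∷ yy₁ ∷ yy₂ ∷ c₂y₁ ∷ c₁y₂ ∷ y₁b₁ ∷ y₂b₂ ∷ c₁b₁ ∷ c₂b₂ ∷ [])) free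
        where
        f : Fin 10 → Fin n
        f = Vec.lookup (x₁ Vec.∷ x₂ Vec.∷ y₁ Vec.∷ y₂ Vec.∷ y Vec.∷ c₁ Vec.∷ c₂ Vec.∷ b₂ Vec.∷ b₁ Vec.∷ x Vec.∷ Vec.[])

        f∈V : ∀ i → V i (f i) ≡ true
        f∈V = λ where
          0F → x₁∈V
          1F → x₂∈V
          2F → y₁∈V
          3F → y₂∈V
          4F → y∈V
          5F → c₁∈V
          6F → c₂∈V
          7F → b₂∈V
          8F → b₁∈V
          9F → x∈V

  infixl 9 _³
  _³ : ℕ → ℕ
  x ³ = x * x * x

  ³-mono-≤ : ∀ {x y} → x ≤ y → x ³ ≤ y ³
  ³-mono-≤ x≤y = *-mono-≤ (*-mono-≤ x≤y x≤y) x≤y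

  ³-mono-< : ∀ {x y} → x < y → x ³ < y ³
  ³-mono-< x<y = *-mono-< (*-mono-< x<y x<y) x<y

  module _ (c : ℕ) .{{_ : NonZero c}} where

    scaled-cube-root : ∀ n → ∃[ b ] (c * b ³ ≤ n × n < c * (suc b) ³)
    scaled-cube-root zero = 0 , ≤-reflexive (*-zeroʳ c) , ≤-trans (>-nonZero⁻¹ c) (≤-reflexive (sym (*-identityʳ c)))
    scaled-cube-root (suc n) with scaled-cube-root n
    ... | b , cb³≤n , n<cb′³ with suc n <? c * (suc b) ³
    ...   | yes n′<cb′³ = b , m≤n⇒m≤1+n cb³≤n , n′<cb′³
    ...   | no  n′≮cb′³ = suc b , ≮⇒≥ n′≮cb′³ , ≤-<-trans n<cb′³ (*-monoʳ-< c (³-mono-< (n<1+n (suc b))))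

    scaled-cube-root-positive : ∀ n → c ≤ n → ∃[ b ] (0 < b × c * b ³ ≤ n × n < c * (2 * b) ³)
    scaled-cube-root-positive n c≤n with scaled-cube-root n
    ... | zero  , _ , n<c = contradiction c≤n (<⇒≱ (subst (n <_) (*-identityʳ c) n<c))
    ... | suc b , cb³≤n , n<cb′³ = suc b , z<s , cb³≤n , <-≤-trans n<cb′³ (*-monoʳ-≤ c (³-mono-≤ {suc (suc b)} {2 * suc b}
      (≤-trans (≤-reflexive (+-comm 1 (suc b))) (+-monoʳ-≤ (suc b) (s≤s z≤n)))))

    root≤ : ∀ {b n} → c * b ³ ≤ n → b ≤ n
    root≤ {zero}      _     = z≤n
    root≤ {b@(suc _)} cb³≤n = ≤-trans (m≤n*m b (b * b)) (≤-trans (m≤n*m (b ³) c) cb³≤n)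

    cube-bound : ∀ {n m b D} → .{{NonZero n}} → 0 < m → n < c * (2 * b) ³ → 2 * b * m ≤ D * (n * n) →
                 m ³ < c * D ³ * (n * n * n * n * n)
    cube-bound {n} {m} {b} {D} 0<m n<8cb³ bound = *-cancelʳ-< n _ _ (begin-strict
      m ³ * n                                <⟨ *-monoʳ-< (m ³) {{m*n≢0 (m * m) m {{m*n≢0 m m}}}} n<8cb³ ⟩
      m ³ * (c * (2 * b) ³)                  ≡⟨ regroup₁ m c (2 * b) ⟩
      c * (2 * b * m) ³                      ≤⟨ *-monoʳ-≤ c (³-mono-≤ bound) ⟩
      c * (D * (n * n)) ³                    ≡⟨ regroup₂ c D n ⟩
      c * D ³ * (n * n * n * n * n) * n      ∎)
      where
      open ≤-Reasoning
      instance
        m≢0 : NonZero m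
        m≢0 = >-nonZero 0<m
      regroup₁ : ∀ m c b → m * m * m * (c * (b * b * b)) ≡ c * ((b * m) * (b * m) * (b * m))
      regroup₁ = solve-∀
      regroup₂ : ∀ c d n → c * ((d * (n * n)) * (d * (n * n)) * (d * (n * n))) ≡ c * (d * d * d) * (n * n * n * n * n) * n
      regroup₂ = solve-∀

  n≤20[n/10] : ∀ n → 20 ≤ n → n ≤ 20 * (n / 10)
  n≤20[n/10] n 20≤n = +-cancelˡ-≤ n _ _ (begin
    n + n                                      ≡⟨ cong₂ _+_ n≡ n≡ ⟩
    (n % 10 + q * 10) + (n % 10 + q * 10)      ≤⟨ +-mono-≤ (+-monoˡ-≤ (q * 10) r≤10) (+-monoˡ-≤ (q * 10) r≤10) ⟩
    (10 + q * 10) + (10 + q * 10)              ≡⟨ regroup q ⟩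
    20 + 20 * q                                ≤⟨ +-monoˡ-≤ (20 * q) 20≤n ⟩
    n + 20 * q                                 ∎)
    where
    open ≤-Reasoning
    q : ℕ
    q = n / 10
    n≡ : n ≡ n % 10 + q * 10
    n≡ = m≡m%n+[m/n]*n n 10
    r≤10 : n % 10 ≤ 10
    r≤10 = <⇒≤ (m%n<n n 10)
    regroup : ∀ q → (10 + q * 10) + (10 + q * 10) ≡ 20 + 20 * q
    regroup = solve-∀

  -- 51200 = 128 · 20², since a part has at least n / 20 vertices.
  parts-large : ∀ K b n → 20 ≤ n → 51200 * K * b ³ ≤ n → 128 * (b * b) * (K * n * b) ≤ (n / 10) * (n / 10)
  parts-large K b n 20≤n small = *-cancelˡ-≤ {128 * (b * b) * (K * n * b)} {(n / 10) * (n / 10)} 400 (begin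
    400 * (128 * (b * b) * (K * n * b))       ≡⟨ regroup₁ K b n ⟩
    51200 * K * (b * b * b) * n               ≤⟨ *-mono-≤ small (n≤20[n/10] n 20≤n) ⟩
    n * (20 * (n / 10))                       ≤⟨ *-monoˡ-≤ (20 * (n / 10)) (n≤20[n/10] n 20≤n) ⟩
    20 * (n / 10) * (20 * (n / 10))           ≡⟨ regroup₂ (n / 10) ⟩
    400 * ((n / 10) * (n / 10))               ∎)
    where
    open ≤-Reasoning
    regroup₁ : ∀ K b n → 400 * (128 * (b * b) * (K * n * b)) ≡ 51200 * K * (b * b * b) * n
    regroup₁ = solve-∀
    regroup₂ : ∀ q → 20 * q * (20 * q) ≡ 400 * (q * q)
    regroup₂ = solve-∀

open Combinatorics using (_³; scaled-cube-root-positive; root≤; cube-bound; parts-large; module Embedding)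

e-full : ∀ {n} (G : Graph n) → e G ⊤ ⊤ ≡ edgeCount G ℕ.* 2
e-full {n} G = ≡.trans (≡.cong List.sum (List.map-cong weight≡2 (edges G))) (constant (edges G))
  where
  weight≡2 : ∀ ij → weight {n} ⊤ ⊤ ij ≡ 2
  weight≡2 (i , j) rewrite Vec.lookup-replicate i inside | Vec.lookup-replicate j inside = ≡.refl

  constant : ∀ {A : Set} (xs : List A) → List.sum (List.map (λ _ → 2) xs) ≡ List.length xs ℕ.* 2
  constant []       = ≡.refl
  constant (x ∷ xs) = ≡.cong (2 ℕ.+_) (constant xs)

module OrderedField (ℝ : RealNumbers) where
  open RealNumbers ℝ
  open RealProperties ℝ
  open RingProperties ring using (-‿+-comm; -‿involutive)
  open SemiringMult (CommutativeRing.semiring commutativeRing) using (×1-homo-*)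
  open RingSolver (CommutativeRing.commutativeSemiring commutativeRing)

  ≤-reflexive : ∀ {x y} → x ≈ y → x ≤ y
  ≤-reflexive x≈y y<x = <-irrefl (sym x≈y) y<x

  ≤-isPreorder : IsPreorder _≈_ _≤_
  ≤-isPreorder = record
    { isEquivalence = CommutativeRing.isEquivalence commutativeRing
    ; reflexive     = ≤-reflexive
    ; trans         = ≤-trans
    }

  <-asym : ∀ {x y} → x < y → ¬ (y < x)
  <-asym x<y y<x = <-irrefl refl (<-trans x<y y<x)

  module ≤-Reasoning = TripleReasoning {_≈_ = _≈_} {_≤_ = _≤_} {_<_ = _<_}
    ≤-isPreorder <-asym <-trans (<-respʳ , <-respˡ) <⇒≤ <-≤-trans ≤-<-trans
  open ≤-Reasoning

  +-monoʳ-≤ : ∀ {x y} z → x ≤ y → z + x ≤ z + y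
  +-monoʳ-≤ {x} {y} z x≤y zy<zx = x≤y (<-respʳ (undo x) (<-respˡ (undo y) (+-monoʳ-< (- z) zy<zx)))
    where
    undo : ∀ x → - z + (z + x) ≈ x
    undo x = trans (sym (+-assoc (- z) z x)) (trans (+-cong (-‿inverseˡ z) refl) (+-identityˡ x))

  +-monoˡ-≤ : ∀ {x y} z → x ≤ y → x + z ≤ y + z
  +-monoˡ-≤ {x} {y} z x≤y = ≤-trans (≤-reflexive (+-comm x z)) (≤-trans (+-monoʳ-≤ z x≤y) (≤-reflexive (+-comm z y)))

  +-cancelʳ-≤ : ∀ {x y} z → x + z ≤ y + z → x ≤ y
  +-cancelʳ-≤ z xz≤yz y<x = xz≤yz (+-mono-< z y<x)

  +-cancelʳ-< : ∀ {x y} z → x + z < y + z → x < y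
  +-cancelʳ-< {x} {y} z xz<yz = <-respˡ (undo x) (<-respʳ (undo y) (+-mono-< (- z) xz<yz))
    where
    undo : ∀ x → x + z - z ≈ x
    undo x = trans (+-assoc x z (- z)) (trans (+-congˡ (-‿inverseʳ z)) (+-identityʳ x))

  *-monoˡ-≤ : ∀ {x y z} → 0# ≤ z → x ≤ y → z * x ≤ z * y
  *-monoˡ-≤ {x} {y} {z} 0≤z x≤y =
    ≤-trans (≤-reflexive (*-comm z x)) (≤-trans (*-monoʳ-≤ 0≤z x≤y) (≤-reflexive (*-comm y z)))

  *-cancelʳ-< : ∀ {x y} z → 0# < z → x * z < y * z → x < y
  *-cancelʳ-< {x} {y} z 0<z xz<yz = <-respˡ (undo x) (<-respʳ (undo y) (÷-mono-< (z , 0<z) xz<yz))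
    where
    undo : ∀ x → x * z ÷ (z , 0<z) ≈ x
    undo x = trans (*-assoc x z _) (trans (*-congˡ (x÷x≈1 (z , 0<z))) (*-identityʳ x))

  *-nonneg : ∀ {x y} → 0# ≤ x → 0# ≤ y → 0# ≤ x * y
  *-nonneg {x} {y} 0≤x 0≤y = ≤-trans (≤-reflexive (sym (zeroˡ y))) (*-monoʳ-≤ 0≤y 0≤x)

  square-cancel-≤ : ∀ {x y} → 0# ≤ y → x * x ≤ y * y → x ≤ y
  square-cancel-≤ {x} {y} 0≤y x²≤y² y<x = x²≤y² (begin-strict
    y * y   ≤⟨ *-monoˡ-≤ 0≤y (<⇒≤ y<x) ⟩
    y * x   <⟨ *-mono-< x (≤-<-trans 0≤y y<x) y<x ⟩
    x * x   ∎)

  square-mono-≤ : ∀ {x y} → 0# ≤ x → x ≤ y → x * x ≤ y * y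
  square-mono-≤ 0≤x x≤y = ≤-trans (*-monoˡ-≤ 0≤x x≤y) (*-monoʳ-≤ (≤-trans 0≤x x≤y) x≤y)

  abs-upper : ∀ {x y z} → abs (x - y) ≤ z → x ≤ y + z
  abs-upper {x} {y} {z} h = begin
    x              ≈⟨ undo ⟩
    y + (x - y)    ≤⟨ +-monoʳ-≤ y (≤-trans (proj₁ (⊔-supremum (x - y) (- (x - y)))) h) ⟩
    y + z          ∎
    where
    undo : x ≈ y + (x - y)
    undo = sym (trans (+-comm y (x - y)) (trans (+-assoc x (- y) y) (trans (+-congˡ (-‿inverseˡ y)) (+-identityʳ x))))

  abs-lower : ∀ {x y z} → abs (x - y) ≤ z → y ≤ x + z
  abs-lower {x} {y} {z} h = begin
    y                ≈⟨ undo ⟩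
    x + - (x - y)    ≤⟨ +-monoʳ-≤ x (≤-trans (proj₁ (proj₂ (⊔-supremum (x - y) (- (x - y))))) h) ⟩
    x + z            ∎
    where
    undo : y ≈ x + - (x - y)
    undo = sym (trans (+-congˡ (sym (-‿+-comm x (- y)))) (trans (sym (+-assoc x (- x) (- - y)))
      (trans (+-cong (-‿inverseʳ x) (-‿involutive y)) (+-identityˡ y))))

  fromℕ-* : ∀ m n → fromℕ (m ℕ.* n) ≈ fromℕ m * fromℕ n
  fromℕ-* = ×1-homo-*

  fromℕ-mono-≤ : ∀ {m n} → m ℕ.≤ n → fromℕ m ≤ fromℕ n
  fromℕ-mono-≤ m≤n with ℕ.m≤n⇒m<n∨m≡n m≤n
  ... | inj₁ m<n    = <⇒≤ (fromℕ-mono-< m<n)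
  ... | inj₂ ≡.refl = ≤-refl

  fromℕ-cancel-≤ : ∀ {m n} → fromℕ m ≤ fromℕ n → m ℕ.≤ n
  fromℕ-cancel-≤ h = ℕ.≮⇒≥ λ n<m → h (fromℕ-mono-< n<m)

  double : ∀ x → fromℕ 2 * x ≈ x + x
  double = solve 1 (λ x → (con 1 :+ (con 1 :+ con 0)) :* x := x :+ x) refl

  module Jumbled {n} (G : Graph n) (C p α : Carrier) (K b : ℕ)
    (0≤C : 0# ≤ C) (4C²+C≤K : fromℕ 4 * (C * C) + C ≤ fromℕ K)
    (0≤p : 0# ≤ p) (0≤α : 0# ≤ α) (α≤ : α ≤ C * √ (fromℕ n * p))
    (jumbled : Exponent.IsJumbled ℝ p α G) where

    B N k : Carrier
    B = fromℕ b
    N = fromℕ n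
    k = fromℕ K

    0≤Np : 0# ≤ N * p
    0≤Np = *-nonneg (0≤fromℕ n) 0≤p

    0≤C² : 0# ≤ fromℕ 4 * (C * C)
    0≤C² = *-nonneg (0≤fromℕ 4) (*-nonneg 0≤C 0≤C)

    4C²≤K : fromℕ 4 * (C * C) ≤ k
    4C²≤K = begin
      fromℕ 4 * (C * C)         ≈⟨ +-identityʳ _ ⟨
      fromℕ 4 * (C * C) + 0#    ≤⟨ +-monoʳ-≤ _ 0≤C ⟩
      fromℕ 4 * (C * C) + C     ≤⟨ 4C²+C≤K ⟩
      k                         ∎

    C≤K : C ≤ k
    C≤K = begin
      C                         ≈⟨ +-identityˡ C ⟨
      0# + C                    ≤⟨ +-monoˡ-≤ C 0≤C² ⟩
      fromℕ 4 * (C * C) + C     ≤⟨ 4C²+C≤K ⟩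
      k                         ∎

    q : Carrier
    q = √ (N * p)

    q²≈Np : q * q ≈ N * p
    q²≈Np = √-square (N * p) 0≤Np

    spread : 1# ≤ B * p → ∀ X Y → 2 ℕ.* b ℕ.* e G X Y ℕ.≤ ∣ X ∣ ℕ.* ∣ Y ∣ → ∣ X ∣ ℕ.* ∣ Y ∣ ℕ.≤ K ℕ.* n ℕ.* b
    spread 1≤Bp X Y sparse = ℕ.≮⇒≥ λ KNb<w → impossible
      (<-respˡ (trans (fromℕ-* (K ℕ.* n) b) (*-congʳ (fromℕ-* K n)))
      (<-respʳ (fromℕ-* ∣ X ∣ ∣ Y ∣) (fromℕ-mono-< KNb<w)))
      where
      E w r P : Carrier
      E = fromℕ (e G X Y)
      w = fromℕ ∣ X ∣ * fromℕ ∣ Y ∣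
      r = √ w
      P = B * p * w

      0≤w : 0# ≤ w
      0≤w = *-nonneg (0≤fromℕ ∣ X ∣) (0≤fromℕ ∣ Y ∣)

      0≤r : 0# ≤ r
      0≤r = √-nonneg w 0≤w

      w≤P : w ≤ P
      w≤P = ≤-trans (≤-reflexive (sym (*-identityˡ w))) (*-monoʳ-≤ 0≤w 1≤Bp)

      0≤P : 0# ≤ P
      0≤P = ≤-trans 0≤w w≤P

      sparse′ : fromℕ 2 * B * E ≤ w
      sparse′ = begin
        fromℕ 2 * B * E                        ≈⟨ *-congʳ (fromℕ-* 2 b) ⟨
        fromℕ (2 ℕ.* b) * E                    ≈⟨ fromℕ-* (2 ℕ.* b) (e G X Y) ⟨
        fromℕ (2 ℕ.* b ℕ.* e G X Y)            ≤⟨ fromℕ-mono-≤ sparse ⟩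
        fromℕ (∣ X ∣ ℕ.* ∣ Y ∣)                 ≈⟨ fromℕ-* ∣ X ∣ ∣ Y ∣ ⟩
        w                                      ∎

      P≤ : P ≤ fromℕ 2 * B * (C * q * r)
      P≤ = +-cancelʳ-≤ P (begin
        P + P                                            ≈⟨ double P ⟨
        fromℕ 2 * (B * p * w)
          ≈⟨ solve 4 (λ d b p w → d :* (b :* p :* w) := d :* b :* (p :* w)) refl (fromℕ 2) B p w ⟩
        fromℕ 2 * B * (p * w)                            ≤⟨ *-monoˡ-≤ 0≤2B (abs-lower (jumbled X Y)) ⟩
        fromℕ 2 * B * (E + α * r)                        ≈⟨ distribˡ _ _ _ ⟩
        fromℕ 2 * B * E + fromℕ 2 * B * (α * r)          ≤⟨ +-monoˡ-≤ _ (≤-trans sparse′ w≤P) ⟩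
        P + fromℕ 2 * B * (α * r)                        ≤⟨ +-monoʳ-≤ P (*-monoˡ-≤ 0≤2B (*-monoʳ-≤ 0≤r α≤)) ⟩
        P + fromℕ 2 * B * (C * q * r)                    ≈⟨ +-comm _ _ ⟩
        fromℕ 2 * B * (C * q * r) + P                    ∎)
        where
        0≤2B : 0# ≤ fromℕ 2 * B
        0≤2B = *-nonneg (0≤fromℕ 2) (0≤fromℕ b)

      P²≤ : P * P ≤ k * N * B * P
      P²≤ = begin
        P * P                                                        ≤⟨ square-mono-≤ 0≤P P≤ ⟩
        (fromℕ 2 * B * (C * q * r)) * (fromℕ 2 * B * (C * q * r))
          ≈⟨ solve 4 (λ b c q r →
               let two = con 1 :+ (con 1 :+ con 0); four = con 1 :+ (con 1 :+ two)
               in (two :* b :* (c :* q :* r)) :* (two :* b :* (c :* q :* r)) :=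
                  four :* (c :* c) :* (b :* b :* (q :* q) :* (r :* r)))
               refl B C q r ⟩
        fromℕ 4 * (C * C) * (B * B * (q * q) * (r * r))
          ≈⟨ *-congˡ (*-cong (*-congˡ q²≈Np) (√-square w 0≤w)) ⟩
        fromℕ 4 * (C * C) * (B * B * (N * p) * w)
          ≤⟨ *-monoʳ-≤ (*-nonneg (*-nonneg (*-nonneg (0≤fromℕ b) (0≤fromℕ b)) 0≤Np) 0≤w) 4C²≤K ⟩
        k * (B * B * (N * p) * w)
          ≈⟨ solve 5 (λ k b n p w → k :* (b :* b :* (n :* p) :* w) := k :* n :* b :* (b :* p :* w)) refl k B N p w ⟩
        k * N * B * P                                                ∎

      impossible : ¬ (k * N * B < w)
      impossible knb<w = P²≤ (*-mono-< P 0<P knb<P)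
        where
        knb<P : k * N * B < P
        knb<P = <-≤-trans knb<w w≤P
        0<P : 0# < P
        0<P = ≤-<-trans (*-nonneg (*-nonneg (0≤fromℕ K) (0≤fromℕ n)) (0≤fromℕ b)) knb<P

    few-edges : b ℕ.≤ n → B * p ≤ 1# → 2 ℕ.* b ℕ.* edgeCount G ℕ.≤ suc K ℕ.* (n ℕ.* n)
    few-edges b≤n Bp≤1 = fromℕ-cancel-≤ (begin
      fromℕ (2 ℕ.* b ℕ.* edgeCount G)    ≈⟨ fromℕ-* (2 ℕ.* b) (edgeCount G) ⟩
      fromℕ (2 ℕ.* b) * m                ≈⟨ *-congʳ (fromℕ-* 2 b) ⟩
      fromℕ 2 * B * m                    ≈⟨ solve 3 (λ d b m → d :* b :* m := b :* (m :* d)) refl (fromℕ 2) B m ⟩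
      B * (m * fromℕ 2)                  ≈⟨ *-congˡ (fromℕ-* (edgeCount G) 2) ⟨
      B * fromℕ (edgeCount G ℕ.* 2)      ≤⟨ *-monoˡ-≤ (0≤fromℕ b) 2m≤ ⟩
      B * (p * w + C * q * r)
        ≈⟨ solve 6 (λ b p w c q r → b :* (p :* w :+ c :* q :* r) := b :* p :* w :+ c :* (b :* q :* r)) refl B p w C q r ⟩
      B * p * w + C * (B * q * r)        ≤⟨ +-monoʳ-≤ _ (*-monoˡ-≤ 0≤C Bqr≤w) ⟩
      B * p * w + C * w                  ≤⟨ +-monoʳ-≤ _ (*-monoʳ-≤ 0≤w C≤K) ⟩
      B * p * w + k * w                  ≤⟨ +-monoˡ-≤ _ (*-monoʳ-≤ 0≤w Bp≤1) ⟩
      1# * w + k * w                     ≈⟨ distribʳ w 1# k ⟨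
      fromℕ (suc K) * w                  ≈⟨ *-congˡ (fromℕ-* n n) ⟨
      fromℕ (suc K) * fromℕ (n ℕ.* n)    ≈⟨ fromℕ-* (suc K) (n ℕ.* n) ⟨
      fromℕ (suc K ℕ.* (n ℕ.* n))        ∎)
      where
      m w r : Carrier
      m = fromℕ (edgeCount G)
      w = N * N
      r = √ w

      0≤w : 0# ≤ w
      0≤w = *-nonneg (0≤fromℕ n) (0≤fromℕ n)

      0≤r : 0# ≤ r
      0≤r = √-nonneg w 0≤w

      2m≤ : fromℕ (edgeCount G ℕ.* 2) ≤ p * w + C * q * r
      2m≤ = begin
        fromℕ (edgeCount G ℕ.* 2)   ≈⟨ CommutativeRing.reflexive commutativeRing (≡.cong fromℕ (e-full G)) ⟨
        fromℕ (e G ⊤ ⊤)             ≤⟨ abs-upper full ⟩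
        p * w + α * r               ≤⟨ +-monoʳ-≤ (p * w) (*-monoʳ-≤ 0≤r α≤) ⟩
        p * w + C * q * r           ∎
        where
        full : abs (fromℕ (e G ⊤ ⊤) - p * w) ≤ α * r
        full = ≡.subst (λ t → abs (fromℕ (e G ⊤ ⊤) - p * (fromℕ t * fromℕ t)) ≤ α * √ (fromℕ t * fromℕ t)) (Subset.∣⊤∣≡n n) (jumbled ⊤ ⊤)

      Bqr≤w : B * q * r ≤ w
      Bqr≤w = square-cancel-≤ 0≤w (begin
        B * q * r * (B * q * r)
          ≈⟨ solve 3 (λ b q r → b :* q :* r :* (b :* q :* r) := b :* b :* (q :* q) :* (r :* r)) refl B q r ⟩
        B * B * (q * q) * (r * r)       ≈⟨ *-cong (*-congˡ q²≈Np) (√-square w 0≤w) ⟩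
        B * B * (N * p) * w
          ≈⟨ solve 4 (λ b n p w → b :* b :* (n :* p) :* w := b :* p :* (b :* (n :* w))) refl B N p w ⟩
        B * p * (B * (N * w))           ≤⟨ *-monoʳ-≤ (*-nonneg (0≤fromℕ b) (*-nonneg (0≤fromℕ n) 0≤w)) Bp≤1 ⟩
        1# * (B * (N * w))              ≈⟨ *-identityˡ _ ⟩
        B * (N * w)                     ≤⟨ *-monoʳ-≤ (*-nonneg (0≤fromℕ n) 0≤w) (fromℕ-mono-≤ b≤n) ⟩
        N * (N * w)                     ≈⟨ *-assoc N N w ⟨
        w * w                           ∎)

  module Logarithm where

    ln : ∀ n → .{{NonZero n}} → Carrier
    ln n = log (fromℕ⁺ n)

    ln-* : ∀ m n → .{{_ : NonZero m}} .{{_ : NonZero n}} .{{_ : NonZero (m ℕ.* n)}} → ln (m ℕ.* n) ≈ ln m + ln n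
    ln-* m n = trans (log-cong _ (fromℕ m * fromℕ n , *-pos (0<fromℕ m) (0<fromℕ n)) (fromℕ-* m n)) (log-* (fromℕ⁺ m) (fromℕ⁺ n) _)

    ln-³ : ∀ n → .{{_ : NonZero n}} .{{_ : NonZero (n ³)}} → ln (n ³) ≈ ln n + ln n + ln n
    ln-³ n = trans (ln-* (n ℕ.* n) n {{n²≢0}}) (+-cong (ln-* n n {{_}} {{_}} {{n²≢0}}) refl)
      where
      instance
        n²≢0 : NonZero (n ℕ.* n)
        n²≢0 = ℕ.m*n≢0 n n

    ln-mono-< : ∀ {m n} → .{{_ : NonZero m}} .{{_ : NonZero n}} → m ℕ.< n → ln m < ln n
    ln-mono-< {m} {n} m<n = log-mono-< (fromℕ⁺ m) (fromℕ⁺ n) (fromℕ-mono-< m<n)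

    ln-power : ∀ j → .{{_ : NonZero (2 ^ j)}} → ln (2 ^ j) ≈ fromℕ j * ln 2
    ln-power zero    = trans (log-cong _ (1# , 0<1) (+-identityʳ 1#)) (trans log1≈0 (sym (zeroˡ (ln 2))))
    ln-power (suc j) = trans (ln-* 2 (2 ^ j) {{_}} {{ℕ.m^n≢0 2 j}}) (trans (+-congˡ (ln-power j {{ℕ.m^n≢0 2 j}}))
      (sym (trans (distribʳ (ln 2) 1# (fromℕ j)) (+-cong (*-identityˡ (ln 2)) refl))))

    0<ln2 : 0# < ln 2
    0<ln2 = proj₂ (Exponent.log⁺ ℝ 0)

    ln-unbounded : ∀ x → ∃[ N ] (∀ n → .{{_ : NonZero n}} → N ℕ.≤ n → x < ln n)
    ln-unbounded x = let j , x÷ln2<j = archimedean (x ÷ ln2⁺) in suc (2 ^ j) , λ n 2^j<n → bound j x÷ln2<j n 2^j<n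
      where
      ln2⁺ : ℝ⁺
      ln2⁺ = ln 2 , 0<ln2
      bound : ∀ j → x ÷ ln2⁺ < fromℕ j → ∀ n → .{{_ : NonZero n}} → 2 ^ j ℕ.< n → x < ln n
      bound j h n 2^j<n = begin-strict
        x                        ≈⟨ x÷y*y≈x x ln2⁺ ⟨
        x ÷ ln2⁺ * ln 2          <⟨ *-mono-< (ln 2) 0<ln2 h ⟩
        fromℕ j * ln 2           ≈⟨ ln-power j {{ℕ.m^n≢0 2 j}} ⟨
        ln (2 ^ j) {{ℕ.m^n≢0 2 j}} <⟨ ln-mono-< {{ℕ.m^n≢0 2 j}} 2^j<n ⟩
        ln n                     ∎

module PetersenExponent (ℝ : RealNumbers) where
  open RealNumbers ℝ
  open RealProperties ℝ
  open Exponent ℝ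
  open OrderedField ℝ
  open Logarithm
  open ≤-Reasoning
  open RingSolver (CommutativeRing.commutativeSemiring commutativeRing)

  cubic-bound : ∀ (C : ℝ⁺) K .{{_ : NonZero K}} → fromℕ 4 * (proj₁ C * proj₁ C) + proj₁ C ≤ fromℕ K →
    ∀ n m → .{{_ : NonZero m}} → 51200 ℕ.* K ℕ.≤ n → IsEdgeCount n C ｛ 10 , petersen ｝ m →
    m ³ ℕ.< 51200 ℕ.* K ℕ.* (suc K) ³ ℕ.* (n ℕ.* n ℕ.* n ℕ.* n ℕ.* n)
  cubic-bound (C , 0<C) K C≤K n m large (G , free , (p , α , (0≤p , p≤1) , 0≤α , α≤ , jumbled) , ≡.refl) =
    conclude (scaled-cube-root-positive c n large)
    where
    c : ℕ
    c = 51200 ℕ.* K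

    20≤n : 20 ℕ.≤ n
    20≤n = ℕ.≤-trans (ℕ.m≤m+n 20 51180) (ℕ.≤-trans (ℕ.m≤m*n 51200 K) large)

    instance
      c≢0 : NonZero c
      c≢0 = ℕ.m*n≢0 51200 K
      n≢0 : NonZero n
      n≢0 = ℕ.>-nonZero (ℕ.<-≤-trans ℕ.z<s 20≤n)
      n/10≢0 : NonZero (n ℕ./ 10)
      n/10≢0 = ℕ.>-nonZero (ℕ.m≥n⇒m/n>0 (ℕ.≤-trans (ℕ.m≤m+n 10 10) 20≤n))

    conclude : ∃[ b ] (0 ℕ.< b × c ℕ.* b ³ ℕ.≤ n × n ℕ.< c ℕ.* (2 ℕ.* b) ³) →
               m ³ ℕ.< c ℕ.* (suc K) ³ ℕ.* (n ℕ.* n ℕ.* n ℕ.* n ℕ.* n)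
    conclude (b , 0<b , cb³≤n , n<8cb³) = decidable-stable (m ³ ℕ.<? c ℕ.* (suc K) ³ ℕ.* (n ℕ.* n ℕ.* n ℕ.* n ℕ.* n)) λ too-many →
      Embedding.petersen-embeds G b (K ℕ.* n ℕ.* b) {{ℕ.>-nonZero 0<b}}
        (spread λ Bp<1 → too-many (cube-bound c {b = b} {D = suc K} (ℕ.>-nonZero⁻¹ m) n<8cb³ (few-edges (root≤ c cb³≤n) (<⇒≤ Bp<1))))
        (parts-large K b n 20≤n cb³≤n)
        (free petersen ≡.refl)
      where
      open Jumbled G C p α K b (<⇒≤ 0<C) C≤K 0≤p 0≤α α≤ jumbled

  module _ (r : Carrier) (2/3<r : 2 / 3 < r) where

    gap : Carrier
    gap = r * fromℕ 3 - fromℕ 2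

    0<gap : 0# < gap
    0<gap = <⇒0<- (<-respˡ (x÷y*y≈x (fromℕ 2) (fromℕ⁺ 3)) (*-mono-< (fromℕ 3) (0<fromℕ 3) 2/3<r))

    gap+2 : gap + fromℕ 2 ≈ r * fromℕ 3
    gap+2 = trans (+-assoc _ _ _) (trans (+-congˡ (-‿inverseˡ (fromℕ 2))) (+-identityʳ _))

    log-ratio-bound : ∀ L n m → .{{_ : NonZero L}} .{{_ : NonZero n}} .{{_ : NonZero m}} →
      m ³ ℕ.< L ℕ.* (n ℕ.* n ℕ.* n ℕ.* n ℕ.* n) → ln L < gap * ln n → log (m /⁺ n) < r * ln n
    log-ratio-bound L n m m³<Ln⁵ lnL<gap = *-cancelʳ-< (fromℕ 3) (0<fromℕ 3) (+-cancelʳ-< (l * fromℕ 3) (begin-strict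
      x * fromℕ 3 + l * fromℕ 3
        ≈⟨ solve 2 (λ x l → x :* three :+ l :* three := (x :+ l) :+ (x :+ l) :+ (x :+ l)) refl x l ⟩
      (x + l) + (x + l) + (x + l)              ≈⟨ +-cong (+-cong x+l≈ x+l≈) x+l≈ ⟩
      ln m + ln m + ln m                       ≈⟨ ln-³ m ⟨
      ln (m ³)                                 <⟨ ln-mono-< m³<Ln⁵ ⟩
      ln (L ℕ.* (n ³ ℕ.* n ℕ.* n))
        ≈⟨ trans (ln-* L (n ³ ℕ.* n ℕ.* n)) (+-congˡ (trans (ln-* (n ³ ℕ.* n) n) (+-cong (trans (ln-* (n ³) n) (+-cong (ln-³ n) refl)) refl))) ⟩
      ln L + (l + l + l + l + l)               <⟨ +-mono-< _ lnL<gap ⟩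
      gap * l + (l + l + l + l + l)
        ≈⟨ solve 2 (λ g l → g :* l :+ (l :+ l :+ l :+ l :+ l) := (g :+ (con 1 :+ (con 1 :+ con 0))) :* l :+ l :* three) refl gap l ⟩
      (gap + fromℕ 2) * l + l * fromℕ 3        ≈⟨ +-cong (*-congʳ gap+2) refl ⟩
      r * fromℕ 3 * l + l * fromℕ 3
        ≈⟨ +-cong (solve 3 (λ r t l → r :* t :* l := r :* l :* t) refl r (fromℕ 3) l) refl ⟩
      r * l * fromℕ 3 + l * fromℕ 3            ∎))
      where
      three : ∀ {k} → Polynomial k
      three = con 1 :+ (con 1 :+ (con 1 :+ con 0))
      l x : Carrier
      l = ln n
      x = log (m /⁺ n)
      instance
        n²≢0 : NonZero (n ℕ.* n)
        n²≢0 = ℕ.m*n≢0 n n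
        n³≢0 : NonZero (n ³)
        n³≢0 = ℕ.m*n≢0 (n ℕ.* n) n
        n⁴≢0 : NonZero (n ³ ℕ.* n)
        n⁴≢0 = ℕ.m*n≢0 (n ³) n
        n⁵≢0 : NonZero (n ³ ℕ.* n ℕ.* n)
        n⁵≢0 = ℕ.m*n≢0 (n ³ ℕ.* n) n
        Ln⁵≢0 : NonZero (L ℕ.* (n ³ ℕ.* n ℕ.* n))
        Ln⁵≢0 = ℕ.m*n≢0 L (n ³ ℕ.* n ℕ.* n)
        m²≢0 : NonZero (m ℕ.* m)
        m²≢0 = ℕ.m*n≢0 m m
        m³≢0 : NonZero (m ³)
        m³≢0 = ℕ.m*n≢0 (m ℕ.* m) m

      x+l≈ : x + l ≈ ln m
      x+l≈ = trans (sym (log-* (m /⁺ n) (fromℕ⁺ n) (*-pos (proj₂ (m /⁺ n)) (0<fromℕ n))))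
        (log-cong _ _ (x÷y*y≈x (fromℕ m) (fromℕ⁺ n)))

    logRatio≺ : ∀ L .{{_ : NonZero L}} n m → (.{{_ : NonZero m}} → m ³ ℕ.< L ℕ.* (n ℕ.* n ℕ.* n ℕ.* n ℕ.* n)) →
      (.{{_ : NonZero n}} → ln L < gap * ln n) → logRatio n m ≺ r
    logRatio≺ L zero          m       _ _ = tt
    logRatio≺ L (suc zero)    m       _ _ = tt
    logRatio≺ L (suc (suc n)) zero    _ _ = tt
    logRatio≺ L (suc (suc n)) (suc m) m³<Ln⁵ lnL<gap = begin-strict
      log (suc m /⁺ suc (suc n)) ÷ log⁺ n
        <⟨ ÷-mono-< (log⁺ n) (log-ratio-bound L (suc (suc n)) (suc m) m³<Ln⁵ lnL<gap) ⟩
      r * ln (suc (suc n)) ÷ log⁺ n          ≈⟨ *-assoc r _ _ ⟩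
      r * (ln (suc (suc n)) ÷ log⁺ n)        ≈⟨ *-congˡ (x÷x≈1 (log⁺ n)) ⟩
      r * 1#                                 ≈⟨ *-identityʳ r ⟩
      r                                      ∎

    term≺ : ∀ C → ∃[ N ] (∀ n m → N ℕ.≤ n → IsEdgeCount n C ｛ 10 , petersen ｝ m → logRatio n m ≺ r)
    term≺ (C , 0<C) =
      let k , C≤k = archimedean (fromℕ 4 * (C * C) + C)
          N , large-ln = ln-unbounded (ln (L k) {{L≢0 k}} ÷ (gap , 0<gap))
      in 51200 ℕ.* suc k ℕ.+ N , λ n m N≤n mₙ →
        logRatio≺ (L k) {{L≢0 k}} n m
          (cubic-bound (C , 0<C) (suc k) (<⇒≤ (<-trans C≤k (fromℕ-mono-< {k} {suc k} (ℕ.n<1+n k)))) n m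
            (ℕ.≤-trans (ℕ.m≤m+n (51200 ℕ.* suc k) N) N≤n) mₙ)
          (<-respˡ (x÷y*y≈x _ (gap , 0<gap))
          (<-respʳ (*-comm _ _) (*-mono-< gap 0<gap
            (large-ln n (ℕ.≤-trans (ℕ.m≤n+m N (51200 ℕ.* suc k)) N≤n)))))
      where
      L : ℕ → ℕ
      L k = 51200 ℕ.* suc k ℕ.* (suc (suc k)) ³
      L≢0 : ∀ k → NonZero (L k)
      L≢0 k = ℕ.m*n≢0 (51200 ℕ.* suc k) ((suc (suc k)) ³) {{ℕ.m*n≢0 51200 (suc k)}}

theorem1p4 : (ℝ : RealNumbers) → let open Exponent ℝ in exp ｛ 10 , petersen ｝ ≼ ⌜ 2 / 3 ⌝
theorem1p4 ℝ q 2/3<q =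
  let r₁ , 2/3<r₁ , r₁<q = dense 2/3<q
      r₂ , r₁<r₂ , r₂<q = dense r₁<q
      r₃ , r₂<r₃ , r₃<q = dense r₂<q
  in (1# , 0<1) , r₃ , r₃<q , λ (C , _) →
    let N , bound = term≺ r₁ 2/3<r₁ C
    in N , r₂ , r₂<r₃ , λ (n , N≤n) → r₁ , r₁<r₂ , λ (m , mₙ , _) → bound n m N≤n mₙ
  where
  open RealNumbers ℝ using (1#; 0<1)
  open RealProperties ℝ using (dense)
  open PetersenExponent ℝ using (term≺)
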